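{- Let $(X,d)$ be a Robinson space with PQ-tree $\mathcal T_{PQ}$. Then the set $\mathcal M_{\max}$ of maximal mmodules of $(X,d)$ is described as follows. (1) If $\mathcal T_{PQ}=P(\beta_1,\dots,\beta_k)$, then $(X,d)$ is non-connected and $X(\beta_1),\dots,X(\beta_k)$ are the $\rho$-mmodules, all of diameter at most $\rho$, and $\mathcal M_{\max}=\{X\setminus X(\beta_1),\dots,X\setminus X(\beta_k)\}$. (2) If $\mathcal T_{PQ}=Q(\beta_1,\dots,\beta_k)$ and $(X,d)$ is connected, then $\mathcal M_{\max}=\{X(\beta_1),\dots,X(\beta_k)\}$. (3) If $\mathcal T_{PQ}=Q(\beta_1,\dots,\beta_k)$ and $(X,d)$ is non-connected, then there is a large $\rho$-mmodule $S_0$, and there exists $i\in\{2,\dots,k-1\}$ such that $S_0=X\setminus X(\beta_i)$. The root of $\mathcal T_{PQ}$ is conical with apex child $\beta_i$. Moreover, letting $c_\rho$ be the number of $\rho$-mmodules: (3.1) if $c_\rho=2$, then $\mathcal M_{\max}=\{X(\beta_i),X\setminus X(\beta_i)\}$; (3.2) if $c_\rho\ge 3$, then $\beta_i=P(\gamma_1,\dots,\gamma_{c_\rho-1})$ is a split node and $\mathcal M_{\max}=\{X\setminus X(\gamma_j):j\in\{1,\dots,c_\rho-1\}\}\cup\{X(\beta_i)\}$.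
   Context: A dissimilarity on a finite set $X$ is a symmetric function $d:X^2\to\mathbb R_{\ge 0}$ with $d(x,y)=0$ if $x=y$. A total order $<$ on $X$ is compatible if $x<y<z$ implies $d(x,z)\ge\max\{d(x,y),d(y,z)\}$. $(X,d)$ is Robinson if it admits a compatible order. $\operatorname{diam}(Y)=\max\{d(x,y):x,y\in Y\}$. A PQ-tree over $X$ is an ordered rooted tree whose leaves are identified with the elements of $X$, whose inner nodes have at least 2 children and are each labelled P-node or Q-node; nodes with exactly 2 children are considered P-nodes. Two PQ-trees are equivalent if one is obtained from the other by a sequence of: arbitrarily permuting the children of a P-node; reversing the order of the children of a Q-node. The PQ-tree represents the set of left-to-right leaf orders of all equivalent PQ-trees. For a Robinson space, $\mathcal T_{PQ}$ is the PQ-tree (unique up to equivalence) representing exactly the set of compatible orders. $P(\beta_1,\dots,\beta_k)$, $Q(\beta_1,\dots,\beta_k)$ denote PQ-trees whose root is a P-node, resp. Q-node, with children $\beta_1,\dots,\beta_k$ in that order. $X(\alpha)$ is the set of leaves below node $\alpha$. An mmodule is a set $M\subseteq X$ such that $d(z,x)=d(z,y)$ for all $z\in X\setminus M$ and $x,y\in M$. $\mathcal M_{\max}$ is the set of inclusion-maximal mmodules different from $X$. For $\delta>0$, $G_{\overline\delta}$ is the graph on $X$ with edges $\{xy: x\ne y,\ d(x,y)\neq\delta\}$; $G_{\overline\delta}(S)$ is its subgraph induced by $S$. Its connected components are the $\delta$-mmodules. Let $\rho$ be the minimum value such that the graph on $X$ with edges $\{xy:x\neq y,\ d(x,y)\le\rho\}$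 is connected. $(X,d)$ is non-connected if $G_{\overline\rho}$ is not connected; otherwise all graphs $G_{\overline\delta}$, $\delta>0$, are connected and $(X,d)$ is called connected. In a non-connected Robinson space, a large $\rho$-mmodule is a $\rho$-mmodule of diameter larger than $\rho$ (there is at most one). A Q-node $\alpha=Q(\beta_1,\dots,\beta_k)$ is $\delta$-conical if it has a child $\beta_i$ (then unique, called the apex child) such that for all $j\ne i$, $d(x,y)=\delta$ for all $x\in X(\beta_i),y\in X(\beta_j)$; it is conical if it is $\delta$-conical for some $\delta>0$. A node $\alpha$ is split if it is the apex child of a $\delta$-conical Q-node and $G_{\overline\delta}(X(\alpha))$ is not connected.
   Formalization: If ρ=0, "conical" and "split" also admit δ=ρ=0 (for ρ>0 nothing changes): with d(x,y)=d(y,z)=0, d(x,z)=1 the root is δ-conical for no δ>0. Values lie in any decidable total order with least element, of which the nonnegative reals are classically an instance. -}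

module Defs where

open import Level using (Level; 0ℓ; _⊔_) renaming (suc to lsuc)
open import Data.Fin.Base using (Fin)
open import Data.Fin.Subset
  using (Subset; ⁅_⁆; ⋃; ⊤; Nonempty; _∈_; _∉_; _⊆_)
open import Data.Fin.Subset.Properties using (_∈?_)
open import Data.List.Base as List
  using (List; []; _∷_; _++_; [_]; length; filter; foldr; allFin; cartesianProductWith)
import Data.List.Membership.Propositional as ListMembership
open import Data.List.Relation.Binary.Permutation.Propositional using (_↭_)
import Data.List.Relation.Binary.Sublist.Propositional as Sublist
open import Data.List.Relation.Unary.Unique.Propositional using (Unique)
open import Data.Nat.Base using (ℕ; _+_)
open import Data.Product.Base using (∃; ∃-syntax; _×_)
open import Data.Sum.Base using (_⊎_)
open import Data.Vec.Base as Vec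
  using (Vec; []; _∷_; lookup; toList; reverse; _[_]≔_)
open import Function.Bundles using (_⇔_)
open import Relation.Binary.Bundles using (DecTotalOrder)
open import Relation.Binary.Construct.Closure.ReflexiveTransitive using (Star)
open import Relation.Binary.Core using (Rel)
open import Relation.Binary.Definitions using (Minimum)
open import Relation.Binary.PropositionalEquality.Core using (_≡_; _≢_)
open import Relation.Binary.Structures using (IsStrictTotalOrder)
open import Relation.Nullary.Negation.Core using (¬_)
open import Relation.Unary using (Pred; _≐_)
import Algebra.Construct.NaturalChoice.Max as Max
import Relation.Binary.Properties.DecTotalOrder as DecTotalOrderProperties

-- The arities encode that inner nodes have at least two children and that a
-- node with exactly two children is a P-node.
data PQTree (n : ℕ) : Set where
  leaf : Fin n → PQTree n
  P    : ∀ {k} → Vec (PQTree n) (2 + k) → PQTree n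
  Q    : ∀ {k} → Vec (PQTree n) (3 + k) → PQTree n

module _ {n : ℕ} where

  -- Left-to-right list of the leaves.
  mutual
    frontier : PQTree n → List (Fin n)
    frontier (leaf x) = [ x ]
    frontier (P ts)   = frontiers ts
    frontier (Q ts)   = frontiers ts

    frontiers : ∀ {k} → Vec (PQTree n) k → List (Fin n)
    frontiers []       = []
    frontiers (t ∷ ts) = frontier t ++ frontiers ts

  -- X(α) for the node α at which the given subtree is rooted.
  X⟨_⟩ : PQTree n → Subset n
  X⟨ t ⟩ = ⋃ (List.map ⁅_⁆ (frontier t))

  -- x occurs before y in the frontier (whose entries are distinct in a
  -- PQ-tree over Fin n).
  LeafOrder : PQTree n → Rel (Fin n) 0ℓ
  LeafOrder t x y = (x ∷ y ∷ []) Sublist.⊆ frontier t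

  infix 4 _⟶_ _≈ᵀ_ _isNodeOf_

  -- One elementary operation, applied at an arbitrary node.
  data _⟶_ : Rel (PQTree n) 0ℓ where
    permute : ∀ {k} {ts us : Vec (PQTree n) (2 + k)} →
              toList ts ↭ toList us → P ts ⟶ P us
    flip    : ∀ {k} (ts : Vec (PQTree n) (3 + k)) → Q ts ⟶ Q (reverse ts)
    belowP  : ∀ {k} (ts : Vec (PQTree n) (2 + k)) i {u} →
              lookup ts i ⟶ u → P ts ⟶ P (ts [ i ]≔ u)
    belowQ  : ∀ {k} (ts : Vec (PQTree n) (3 + k)) i {u} →
              lookup ts i ⟶ u → Q ts ⟶ Q (ts [ i ]≔ u)

  _≈ᵀ_ : Rel (PQTree n) 0ℓ
  _≈ᵀ_ = Star _⟶_

  Represents : PQTree n → Rel (Fin n) 0ℓ → Set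
  Represents t _≺_ = ∃[ u ] (t ≈ᵀ u × (∀ x y → x ≺ y ⇔ LeafOrder u x y))

  -- The leaves of a PQ-tree being distinct, a node is determined by the
  -- subtree rooted at it.
  data _isNodeOf_ (s : PQTree n) : PQTree n → Set where
    root   : s isNodeOf s
    childP : ∀ {k} (ts : Vec (PQTree n) (2 + k)) i →
             s isNodeOf lookup ts i → s isNodeOf P ts
    childQ : ∀ {k} (ts : Vec (PQTree n) (3 + k)) i →
             s isNodeOf lookup ts i → s isNodeOf Q ts

  Connected : ∀ {e} → Rel (Fin n) e → Set e
  Connected E = ∀ x y → Star E x y

  -- The subgraph induced by S is connected.
  ConnectedOn : ∀ {e} → Rel (Fin n) e → Subset n → Set e
  ConnectedOn E S =
    ∀ x y → x ∈ S → y ∈ S → Star (λ u v → u ∈ S × v ∈ S × E u v) x y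

  -- For a symmetric E.
  IsComponent : ∀ {e} → Rel (Fin n) e → Subset n → Set e
  IsComponent E S = Nonempty S × (∀ x y → x ∈ S → (y ∈ S ⇔ Star E x y))

  HasCardinality : ∀ {p} → Pred (Subset n) p → ℕ → Set p
  HasCardinality 𝓕 c =
    ∃[ L ] (Unique L × 𝓕 ≐ (λ S → S ListMembership.∈ L) × length L ≡ c)

-- Dissimilarities enter only through comparisons with each other and with 0.
-- Accordingly the half-line of nonnegative reals is replaced by an arbitrary
-- decidable total order with least element 0#.  The points are Fin size.
record DissimilaritySpace c ℓ₁ ℓ₂ : Set (lsuc (c ⊔ ℓ₁ ⊔ ℓ₂)) where
  field
    values : DecTotalOrder c ℓ₁ ℓ₂

  open DecTotalOrder values public using (_≈_; _≤_) renaming (Carrier to Value)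
  open DecTotalOrderProperties values public using (_<_)
  open Max (DecTotalOrder.totalOrder values) public using () renaming (_⊔_ to max)

  field
    0#    : Value
    0-min : Minimum _≤_ 0#
    size  : ℕ
    d     : Fin size → Fin size → Value
    d-sym : ∀ x y → d x y ≈ d y x
    d-refl : ∀ x → d x x ≈ 0#

module Space {c ℓ₁ ℓ₂ : Level} (S : DissimilaritySpace c ℓ₁ ℓ₂) where

  open DissimilaritySpace S public

  Compatible : Rel (Fin size) 0ℓ → Set ℓ₂
  Compatible _≺_ = ∀ x y z → x ≺ y → y ≺ z → max (d x y) (d y z) ≤ d x z

  IsTotalOrdering : Rel (Fin size) 0ℓ → Set
  IsTotalOrdering _≺_ = IsStrictTotalOrder _≡_ _≺_

  Robinson : Set (lsuc 0ℓ ⊔ ℓ₂)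
  Robinson = ∃[ _≺_ ] (IsTotalOrdering _≺_ × Compatible _≺_)

  -- T is a PQ-tree with leaf set exactly Fin size, and it represents exactly
  -- the compatible orders.
  IsPQTreeOfSpace : PQTree size → Set (lsuc 0ℓ ⊔ ℓ₂)
  IsPQTreeOfSpace T =
    frontier T ↭ allFin size ×
    (∀ _≺_ → IsTotalOrdering _≺_ → (Compatible _≺_ ⇔ Represents T _≺_))

  -- For nonempty Y the seed 0# does not matter, 0# being the least value.
  diam : Subset size → Value
  diam Y = foldr max 0# (cartesianProductWith d elements elements)
    where
    elements : List (Fin size)
    elements = filter (_∈? Y) (allFin size)

  IsMmodule : Pred (Subset size) ℓ₁
  IsMmodule M = ∀ z x y → z ∉ M → x ∈ M → y ∈ M → d z x ≈ d z y

  𝓜max : Pred (Subset size) ℓ₁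
  𝓜max M = IsMmodule M × M ≢ ⊤ ×
    (∀ N → IsMmodule N → N ≢ ⊤ → M ⊆ N → N ≡ M)

  Gᶜ : Value → Rel (Fin size) ℓ₁
  Gᶜ δ x y = x ≢ y × ¬ (d x y ≈ δ)

  IsMmoduleAt : Value → Pred (Subset size) ℓ₁
  IsMmoduleAt δ = IsComponent (Gᶜ δ)

  G≤ : Value → Rel (Fin size) ℓ₂
  G≤ v x y = x ≢ y × d x y ≤ v

  IsRho : Value → Set (c ⊔ ℓ₂)
  IsRho ρ = Connected (G≤ ρ) × (∀ v → Connected (G≤ v) → ρ ≤ v)

  ConnectedSpace NonConnectedSpace : Value → Set ℓ₁
  ConnectedSpace    ρ = Connected (Gᶜ ρ)
  NonConnectedSpace ρ = ¬ Connected (Gᶜ ρ)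

  IsLargeMmoduleAt : Value → Pred (Subset size) (ℓ₁ ⊔ ℓ₂)
  IsLargeMmoduleAt ρ M = IsMmoduleAt ρ M × ρ < diam M

  -- The parameter δ ranges over the positive values, and over ρ.  The second
  -- alternative matters only when ρ is 0, which happens when distinct points
  -- at distance 0 already connect the space: non-connectedness is then about
  -- δ = 0.  For example, with d x y = d y z = 0 and d x z = 1, the tree
  -- Q(x, y, z) is 0-conical with apex child y and δ-conical for no positive δ.
  Admissible : (ρ δ : Value) → Set (ℓ₁ ⊔ ℓ₂)
  Admissible ρ δ = 0# < δ ⊎ δ ≈ ρ

  -- Q β is δ-conical with apex child lookup β i.
  IsApex : ∀ {k} → Value → Vec (PQTree size) (3 + k) → Fin (3 + k) → Set ℓ₁
  IsApex δ β i = ∀ j → j ≢ i → ∀ x y →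
    x ∈ X⟨ lookup β i ⟩ → y ∈ X⟨ lookup β j ⟩ → d x y ≈ δ

  -- Q β is conical with apex child lookup β i.
  IsConicalWithApex : ∀ {k} → Value → Vec (PQTree size) (3 + k) → Fin (3 + k) →
                      Set (c ⊔ ℓ₁ ⊔ ℓ₂)
  IsConicalWithApex ρ β i = ∃[ δ ] (Admissible ρ δ × IsApex δ β i)

  -- α is a split node of T.
  IsSplit : Value → PQTree size → PQTree size → Set (c ⊔ ℓ₁ ⊔ ℓ₂)
  IsSplit ρ T α =
    ∃[ k ] ∃[ β ] ∃[ i ] ∃[ δ ]
      (Q {k = k} β isNodeOf T × lookup β i ≡ α × Admissible ρ δ ×
       IsApex δ β i × ¬ ConnectedOn (Gᶜ δ) X⟨ α ⟩)

{-# OPTIONS --safe #-}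

-- New compatible orders are made from a given one in two ways: by replacing its
-- restriction to a contiguous mmodule, or by concatenating compatible orders of the
-- two sides of a cut (A, ∁ A) across which all distances are equal to the largest
-- distance.  Since the PQ-tree represents all of them, a Q-node admits no such cut, a
-- contiguous mmodule that is not everything lies below one child of a Q-root, and
-- under a P-node the distance between different children is constant and maximal, each
-- child being connected by the pairs at other distances.
--
-- If the space is non-connected, an mmodule that omits a point misses some
-- ρ-mmodule entirely, so the maximal mmodules are the complements of the ρ-mmodules,
-- which are read off the tree.  Under a Q-root some distance d(a, b) exceeds ρ (no cut),
-- and the points outside the component S₀ of a and b all lie between a and b; they
-- form a contiguous mmodule, hence a child of the root.  If the space is connected,
-- a maximal mmodule is contiguous: otherwise its convex hull would be everything, and
-- the distance from the mmodule to its complement would be constant.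
module Submission where

open import Defs
import Algebra.Construct.NaturalChoice.Max as Max
import Algebra.Construct.NaturalChoice.MaxOp as MaxOp
open import Data.Bool.Base using (true)
open import Data.Bool.Properties using () renaming (_≟_ to _≟ᵇ_)
open import Data.Empty using (⊥; ⊥-elim)
open import Data.Fin.Base as Fin using (Fin; zero; suc; fromℕ; inject₁; opposite; punchOut)
import Data.Fin.Properties as Fin
open import Data.Fin.Subset using (Subset; ⁅_⁆; ⋃; _∪_; _∈_; _∉_; _⊆_; _⊃_; ∁; ⊤)
open import Data.Fin.Subset.Induction using (⊃-wellFounded)
open import Data.Fin.Subset.Properties
  using (_∈?_; _⊆?_; anySubset?; x∈⁅x⁆; x∈⁅y⁆⇒x≡y; x∈p∪q⁺; x∈p∪q⁻; p⊆p∪q; ⊆-antisym; ∉⊥; ∈⊤;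
         x∈p⇒x∉∁p; x∈∁p⇒x∉p; x∉p⇒x∈∁p; x∉∁p⇒x∈p)
open import Data.List.Base as List using (List; []; _∷_; _++_; concatMap; allFin; foldr)
import Data.List.Membership.DecPropositional as DecMembership
open import Data.List.Membership.Propositional using () renaming (_∈_ to _∈ₗ_; _∉_ to _∉ₗ_)
open import Data.List.Membership.Propositional.Properties
  using (∈-++⁺ˡ; ∈-++⁻; ∈-allFin; ∈-tabulate⁺; ∈-tabulate⁻; ∈-filter⁺; ∈-filter⁻;
         ∈-cartesianProductWith⁺; ∈-cartesianProductWith⁻)
open import Data.List.Membership.Propositional.Properties.WithK using (unique∧set⇒bag)
import Data.List.Properties as List
open import Data.List.Relation.Binary.BagAndSetEquality using (∼bag⇒↭)
open import Data.List.Relation.Binary.Permutation.Propositional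
  using (_↭_; prep; swap; ↭-refl; ↭-sym; ↭-trans; ↭⇒↭ₛ)
  renaming (refl to ↭refl; trans to ↭trans)
open import Data.List.Relation.Binary.Permutation.Propositional.Properties
  using (∈-resp-↭; ++⁺ˡ; ++⁺ʳ; shifts; ↭-reverse; ↭-length)
import Data.List.Relation.Binary.Permutation.Setoid.Properties as Permutationₛ
open import Data.List.Relation.Binary.Sublist.Propositional as Sublist
  using ([]; _∷_; _∷ʳ_; from∈; to∈)
open import Data.List.Relation.Binary.Sublist.Propositional.Properties
  using (All-resp-⊆) renaming (++⁺ˡ to ⊆-++⁺ˡ; ++⁺ʳ to ⊆-++⁺ʳ; ++⁺ to ⊆-++⁺)
open import Data.List.Relation.Unary.All using (_∷_)
open import Data.List.Relation.Unary.All.Properties using (tabulate⁺)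
open import Data.List.Relation.Unary.AllPairs using ([]; _∷_)
open import Data.List.Relation.Unary.Any using (here; there)
open import Data.List.Relation.Unary.Unique.Propositional using (Unique)
import Data.List.Relation.Unary.Unique.Propositional.Properties as Unique
open import Data.Nat.Base as ℕ using (ℕ; _+_; _∸_; _≥_)
import Data.Nat.Properties as ℕ
open import Data.Product.Base using (_×_; ∃-syntax; _,_; proj₁; proj₂)
open import Data.Sum.Base as Sum using (_⊎_; inj₁; inj₂)
open import Data.Vec.Base as Vec using (Vec; []; _∷_; lookup; toList; reverse; removeAt; tabulate; _[_]≔_)
import Data.Vec.Properties as Vec
open import Function.Base using (_∘_; id; case_of_)
open import Function.Bundles using (_⇔_; mk⇔; Equivalence)
open import Induction.WellFounded using (Acc; acc)
open import Level using (0ℓ; _⊔_) renaming (suc to lsuc)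
open import Relation.Binary.Bundles using (DecTotalOrder)
open import Relation.Binary.Construct.Closure.ReflexiveTransitive as Star using (Star; ε; _◅_; _◅◅_)
open import Relation.Binary.Core using (Rel; _⇒_)
open import Relation.Binary.Definitions
  using (Tri; tri<; tri≈; tri>; Transitive; Symmetric) renaming (Decidable to Decidable₂)
import Relation.Binary.Properties.DecTotalOrder as DecTotalOrderProperties
open import Relation.Binary.PropositionalEquality
open import Relation.Binary.Structures using (IsStrictTotalOrder)
open import Relation.Nullary using (¬_; Dec; yes; no; does)
open import Relation.Nullary.Decidable using (decidable-stable; dec-true; ¬?; _×-dec_; _→-dec_)
open import Relation.Unary using (Pred; Decidable; _≐_)

-- Order of occurrence in a list.

module _ {a} {A : Set a} where

  -- `LeafOrder t` unfolds to `Before (frontier t)`, so what is proved for lists applies to leaf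
  -- orders as it stands.
  Before : List A → Rel A a
  Before xs x y = (x ∷ y ∷ []) Sublist.⊆ xs

  private variable
    x y z : A
    xs ys : List A

  before-∈ˡ : Before xs x y → x ∈ₗ xs
  before-∈ˡ b = Sublist.lookup b (here refl)

  before-∈ʳ : Before xs x y → y ∈ₗ xs
  before-∈ʳ b = Sublist.lookup b (there (here refl))

  before-++ : x ∈ₗ xs → y ∈ₗ ys → Before (xs ++ ys) x y
  before-++ p q = ⊆-++⁺ (from∈ p) (from∈ q)

  before-irrefl : Unique xs → ¬ Before xs x x
  before-irrefl u       (refl ∷ p) = Unique.Unique[x∷xs]⇒x∉xs u (to∈ p)
  before-irrefl (_ ∷ u) (_ ∷ʳ p)   = before-irrefl u p

  before-trans : Unique xs → Before xs x y → Before xs y z → Before xs x z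
  before-trans u       (refl ∷ p) (refl ∷ q) = ⊥-elim (Unique.Unique[x∷xs]⇒x∉xs u (to∈ p))
  before-trans u       (refl ∷ p) (_ ∷ʳ q)   = refl ∷ from∈ (before-∈ʳ q)
  before-trans u       (_ ∷ʳ p)   (refl ∷ q) = ⊥-elim (Unique.Unique[x∷xs]⇒x∉xs u (before-∈ʳ p))
  before-trans (_ ∷ u) (w ∷ʳ p)   (_ ∷ʳ q)   = w ∷ʳ before-trans u p q

  before-total : x ∈ₗ xs → y ∈ₗ xs → x ≢ y → Before xs x y ⊎ Before xs y x
  before-total (here refl) (here refl) x≢y = ⊥-elim (x≢y refl)
  before-total (here refl) (there q)   x≢y = inj₁ (refl ∷ from∈ q)
  before-total (there p)   (here refl) x≢y = inj₂ (refl ∷ from∈ p)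
  before-total (there p)   (there q)   x≢y = Sum.map (_ ∷ʳ_) (_ ∷ʳ_) (before-total p q x≢y)

  unique-↭ : xs ↭ ys → Unique xs → Unique ys
  unique-↭ p = Permutationₛ.Unique-resp-↭ (setoid A) (↭⇒↭ₛ p)

  unique-⊆ : xs Sublist.⊆ ys → Unique ys → Unique xs
  unique-⊆ []         _       = []
  unique-⊆ (_ ∷ʳ p)   (_ ∷ u) = unique-⊆ p u
  unique-⊆ (refl ∷ p) (a ∷ u) = All-resp-⊆ p a ∷ unique-⊆ p u

-- Permutations of lists and vectors.

concatMap-↭ : ∀ {a b} {A : Set a} {B : Set b} (f : A → List B) {xs ys} →
              xs ↭ ys → concatMap f xs ↭ concatMap f ys
concatMap-↭ f ↭refl          = ↭-refl
concatMap-↭ f (prep x p)     = ++⁺ˡ (f x) (concatMap-↭ f p)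
concatMap-↭ f (swap x y p)   = ↭-trans (++⁺ˡ (f x) (++⁺ˡ (f y) (concatMap-↭ f p))) (shifts (f x) (f y))
concatMap-↭ f (↭trans p q)   = ↭-trans (concatMap-↭ f p) (concatMap-↭ f q)

module _ {a} {A : Set a} where

  lookup-∷ʳ-fromℕ : ∀ {n} (x : A) (xs : Vec A n) → lookup (xs Vec.∷ʳ x) (fromℕ n) ≡ x
  lookup-∷ʳ-fromℕ x []       = refl
  lookup-∷ʳ-fromℕ x (_ ∷ xs) = lookup-∷ʳ-fromℕ x xs

  lookup-∷ʳ-inject₁ : ∀ {n} (x : A) (xs : Vec A n) i → lookup (xs Vec.∷ʳ x) (inject₁ i) ≡ lookup xs i
  lookup-∷ʳ-inject₁ x (_ ∷ xs) zero    = refl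
  lookup-∷ʳ-inject₁ x (_ ∷ xs) (suc i) = lookup-∷ʳ-inject₁ x xs i

  lookup-reverse : ∀ {n} (xs : Vec A n) i → lookup (reverse xs) (opposite i) ≡ lookup xs i
  lookup-reverse (x ∷ xs) i rewrite Vec.reverse-∷ x xs with i
  ... | zero  = lookup-∷ʳ-fromℕ x (reverse xs)
  ... | suc j = trans (lookup-∷ʳ-inject₁ x (reverse xs) (opposite j)) (lookup-reverse xs j)

  lookup-∈ : ∀ {n} (xs : Vec A n) i → lookup xs i ∈ₗ toList xs
  lookup-∈ (x ∷ xs) zero    = here refl
  lookup-∈ (x ∷ xs) (suc i) = there (lookup-∈ xs i)

  ∈-lookup : ∀ {n} (xs : Vec A n) {x} → x ∈ₗ toList xs → ∃[ i ] lookup xs i ≡ x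
  ∈-lookup (x ∷ xs) (here refl) = zero , refl
  ∈-lookup (x ∷ xs) (there p) with i , eq ← ∈-lookup xs p = suc i , eq

  removeAt-↭ : ∀ {n} (xs : Vec A (ℕ.suc n)) i → toList xs ↭ lookup xs i ∷ toList (removeAt xs i)
  removeAt-↭ (x ∷ xs)     zero    = ↭-refl
  removeAt-↭ (x ∷ y ∷ xs) (suc i) = ↭-trans (prep x (removeAt-↭ (y ∷ xs) i)) (swap _ _ ↭-refl)

  -- After entry `i` is removed, entry `j` sits at `punchOut i≢j`. Thus a single `permute` makes any
  -- two children of a P-node its first two.
  bring-two-front : ∀ {n} (xs : Vec A (2 + n)) {i j} → i ≢ j →
    ∃[ ys ] toList xs ↭ toList (lookup xs i ∷ lookup xs j ∷ ys)
  bring-two-front xs {i} {j} i≢j = removeAt rest j′ ,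
    ↭-trans (removeAt-↭ xs i) (prep _
      (subst (λ v → toList rest ↭ v ∷ toList (removeAt rest j′))
        (Vec.removeAt-punchOut xs i≢j) (removeAt-↭ rest j′)))
    where
    rest = removeAt xs i
    j′   = punchOut i≢j

opposite-< : ∀ {n} {i j : Fin n} → i Fin.< j → opposite j Fin.< opposite i
opposite-< {n} {i} {j} i<j rewrite Fin.opposite-prop i | Fin.opposite-prop j =
  ℕ.∸-monoʳ-< (ℕ.s≤s i<j) (Fin.toℕ<n j)

-- Leaf orders of equivalent PQ-trees.

module _ {n : ℕ} where

  private variable
    m   : ℕ
    x y : Fin n
    t u : PQTree n

  someLeaf : (t : PQTree n) → ∃[ x ] x ∈ₗ frontier t
  someLeaf (leaf x)    = x , here refl
  someLeaf (P (t ∷ _)) with x , p ← someLeaf t = x , ∈-++⁺ˡ p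
  someLeaf (Q (t ∷ _)) with x , p ← someLeaf t = x , ∈-++⁺ˡ p

  block-⊆ : (ts : Vec (PQTree n) m) (i : Fin m) → frontier (lookup ts i) Sublist.⊆ frontiers ts
  block-⊆ (t ∷ ts) zero    = ⊆-++⁺ʳ _ Sublist.⊆-refl
  block-⊆ (t ∷ ts) (suc i) = ⊆-++⁺ˡ (frontier t) (block-⊆ ts i)

  ∈-frontiers⁺ : (ts : Vec (PQTree n) m) (i : Fin m) → x ∈ₗ frontier (lookup ts i) → x ∈ₗ frontiers ts
  ∈-frontiers⁺ ts i = Sublist.lookup (block-⊆ ts i)

  ∈-frontiers⁻ : (ts : Vec (PQTree n) m) → x ∈ₗ frontiers ts → ∃[ i ] x ∈ₗ frontier (lookup ts i)
  ∈-frontiers⁻ (t ∷ ts) p with ∈-++⁻ (frontier t) p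
  ... | inj₁ q = zero , q
  ... | inj₂ q with i , r ← ∈-frontiers⁻ ts q = suc i , r

  before-blocks : (ts : Vec (PQTree n) m) {i j : Fin m} → i Fin.< j →
    x ∈ₗ frontier (lookup ts i) → y ∈ₗ frontier (lookup ts j) → Before (frontiers ts) x y
  before-blocks (t ∷ ts) {zero}  {suc j} i<j p q = before-++ p (∈-frontiers⁺ ts j q)
  before-blocks (t ∷ ts) {suc i} {suc j} i<j p q =
    ⊆-++⁺ˡ (frontier t) (before-blocks ts (ℕ.s<s⁻¹ i<j) p q)

  block-unique : (ts : Vec (PQTree n) m) → Unique (frontiers ts) → ∀ {i j} →
    x ∈ₗ frontier (lookup ts i) → x ∈ₗ frontier (lookup ts j) → i ≡ j
  block-unique ts u {i} {j} p q with Fin.<-cmp i j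
  ... | tri< i<j _ _ = ⊥-elim (before-irrefl u (before-blocks ts i<j p q))
  ... | tri≈ _ eq _  = eq
  ... | tri> _ _ j<i = ⊥-elim (before-irrefl u (before-blocks ts j<i q p))

  frontiers-concatMap : (ts : Vec (PQTree n) m) → frontiers ts ≡ concatMap frontier (toList ts)
  frontiers-concatMap []       = refl
  frontiers-concatMap (t ∷ ts) = cong (frontier t ++_) (frontiers-concatMap ts)

  frontiers-↭ : ∀ {m m′} (ts : Vec (PQTree n) m) (us : Vec (PQTree n) m′) →
    toList ts ↭ toList us → frontiers ts ↭ frontiers us
  frontiers-↭ ts us p rewrite frontiers-concatMap ts | frontiers-concatMap us = concatMap-↭ frontier p

  frontiers-≔ : (ts : Vec (PQTree n) m) (i : Fin m) →
    frontier (lookup ts i) ↭ frontier u → frontiers ts ↭ frontiers (ts [ i ]≔ u)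
  frontiers-≔ (t ∷ ts) zero    p = ++⁺ʳ (frontiers ts) p
  frontiers-≔ (t ∷ ts) (suc i) p = ++⁺ˡ (frontier t) (frontiers-≔ ts i p)

  reverse-↭ : ∀ {a} {A : Set a} (xs : Vec A m) → toList xs ↭ toList (reverse xs)
  reverse-↭ xs rewrite Vec.toList-reverse xs = ↭-sym (↭-reverse (toList xs))

  ⟶-frontier : t ⟶ u → frontier t ↭ frontier u
  ⟶-frontier (permute {ts = ts} {us} p) = frontiers-↭ ts us p
  ⟶-frontier (flip ts)        = frontiers-↭ ts (reverse ts) (reverse-↭ ts)
  ⟶-frontier (belowP ts i s)  = frontiers-≔ ts i (⟶-frontier s)
  ⟶-frontier (belowQ ts i s)  = frontiers-≔ ts i (⟶-frontier s)

  ≈ᵀ-frontier : t ≈ᵀ u → frontier t ↭ frontier u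
  ≈ᵀ-frontier ε        = ↭-refl
  ≈ᵀ-frontier (s ◅ ss) = ↭-trans (⟶-frontier s) (≈ᵀ-frontier ss)

  update-child : (ts : Vec (PQTree n) m) (i : Fin m) → lookup ts i ⟶ u →
    ∀ j → lookup ts j ≈ᵀ lookup (ts [ i ]≔ u) j
  update-child {u = u} ts i s j with i Fin.≟ j
  ... | yes refl rewrite Vec.lookup∘update i ts u = s ◅ ε
  ... | no i≢j   rewrite Vec.lookup∘update′ (i≢j ∘ sym) ts u = ε

  -- Only the parity of the flips at the root matters: each `flip` exchanges the two alternatives,
  -- and an operation below the root changes one child within its equivalence class.
  Q-children : ∀ {k} {ts : Vec (PQTree n) (3 + k)} → Q ts ≈ᵀ u → ∃[ us ] (u ≡ Q us ×
    ((∀ i → lookup ts i ≈ᵀ lookup us i) ⊎ (∀ i → lookup ts i ≈ᵀ lookup us (opposite i))))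
  Q-children ε = _ , refl , inj₁ λ _ → ε
  Q-children (flip ts ◅ ss) with Q-children ss
  ... | us , eq , inj₁ f = us , eq , inj₂ λ i →
    subst (_≈ᵀ _) (lookup-reverse ts i) (f (opposite i))
  ... | us , eq , inj₂ f = us , eq , inj₁ λ i →
    subst₂ (λ v j → v ≈ᵀ lookup us j) (lookup-reverse ts i) (Fin.opposite-involutive i) (f (opposite i))
  Q-children (belowQ ts i s ◅ ss) with Q-children ss
  ... | us , eq , inj₁ f = us , eq , inj₁ λ j → update-child ts i s j ◅◅ f j
  ... | us , eq , inj₂ f = us , eq , inj₂ λ j → update-child ts i s j ◅◅ f j

  -- Where a child lands is left open. What matters is that its leaves still form a block, and so
  -- fill consecutive places.
  P-blocks : ∀ {k} {ts : Vec (PQTree n) (2 + k)} → P ts ≈ᵀ u → ∃[ us ] (u ≡ P {k = k} us ×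
    (∀ i → ∃[ j ] frontier (lookup ts i) ↭ frontier (lookup us j)))
  P-blocks ε = _ , refl , λ i → i , ↭-refl
  P-blocks (permute {ts = ts} {vs} p ◅ ss) with us , eq , f ← P-blocks ss =
    us , eq , λ i → let j , e = ∈-lookup vs (∈-resp-↭ p (lookup-∈ ts i)) in
      subst (λ v → ∃[ j ] frontier v ↭ frontier (lookup us j)) e (f j)
  P-blocks (belowP ts i s ◅ ss) with us , eq , f ← P-blocks ss =
    us , eq , λ j → let j′ , q = f j in j′ , ↭-trans (≈ᵀ-frontier (update-child ts i s j)) q

  Q-order : ∀ {k} {ts : Vec (PQTree n) (3 + k)} → Q ts ≈ᵀ u →
    (∀ {i j x y} → i Fin.< j → x ∈ₗ frontier (lookup ts i) → y ∈ₗ frontier (lookup ts j) → LeafOrder u x y) ⊎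
    (∀ {i j x y} → i Fin.< j → x ∈ₗ frontier (lookup ts i) → y ∈ₗ frontier (lookup ts j) → LeafOrder u y x)
  Q-order ss with Q-children ss
  ... | us , refl , inj₁ f = inj₁ λ {i} {j} i<j p q →
    before-blocks us i<j (∈-resp-↭ (≈ᵀ-frontier (f i)) p) (∈-resp-↭ (≈ᵀ-frontier (f j)) q)
  ... | us , refl , inj₂ f = inj₂ λ {i} {j} i<j p q →
    before-blocks us (opposite-< i<j) (∈-resp-↭ (≈ᵀ-frontier (f j)) q) (∈-resp-↭ (≈ᵀ-frontier (f i)) p)

  -- Serves to cut an order realized by the whole Q-node down to one child.
  Q-child : ∀ {k} {ts : Vec (PQTree n) (3 + k)} → Q ts ≈ᵀ u → ∀ i →
    ∃[ w ] (lookup ts i ≈ᵀ w × (∀ {x y} → LeafOrder w x y → LeafOrder u x y))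
  Q-child ss i with Q-children ss
  ... | us , refl , inj₁ f = lookup us i , f i , λ b → Sublist.⊆-trans b (block-⊆ us i)
  ... | us , refl , inj₂ f = lookup us (opposite i) , f i , λ b → Sublist.⊆-trans b (block-⊆ us (opposite i))

  P-contiguous : ∀ {k} {ts : Vec (PQTree n) (2 + k)} → P ts ≈ᵀ u → ∀ i {y} →
    y ∈ₗ frontiers ts → y ∉ₗ frontier (lookup ts i) →
    (∀ {x} → x ∈ₗ frontier (lookup ts i) → LeafOrder u x y) ⊎
    (∀ {x} → x ∈ₗ frontier (lookup ts i) → LeafOrder u y x)
  P-contiguous ss i y∈ y∉ with P-blocks ss
  ... | us , refl , f with f i | ∈-frontiers⁻ us (∈-resp-↭ (≈ᵀ-frontier ss) y∈)
  ... | j , p | j′ , y∈j′ with Fin.<-cmp j j′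
  ... | tri< j<j′ _ _  = inj₁ λ x∈ → before-blocks us j<j′ (∈-resp-↭ p x∈) y∈j′
  ... | tri≈ _ refl _  = ⊥-elim (y∉ (∈-resp-↭ (↭-sym p) y∈j′))
  ... | tri> _ _ j′<j  = inj₂ λ x∈ → before-blocks us j′<j y∈j′ (∈-resp-↭ p x∈)

-- Strict total orders

module _ {n : ℕ} where

  IsOrder : Rel (Fin n) 0ℓ → Set
  IsOrder = IsStrictTotalOrder _≡_

  mkOrder : {_≺_ : Rel (Fin n) 0ℓ} → (∀ {x} → ¬ x ≺ x) → Transitive _≺_ →
            (∀ {x y} → x ≢ y → x ≺ y ⊎ y ≺ x) → IsOrder _≺_
  mkOrder {_≺_} irr tr total = record
    { isStrictPartialOrder = record
      { isEquivalence = isEquivalence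
      ; irrefl        = λ { refl → irr }
      ; trans         = tr
      ; <-resp-≈      = resp₂ _≺_
      }
    ; compare = compare
    }
    where
    compare : ∀ x y → Tri (x ≺ y) (x ≡ y) (y ≺ x)
    compare x y with x Fin.≟ y
    ... | yes refl = tri≈ irr refl irr
    ... | no x≢y with total x≢y
    ...   | inj₁ p = tri< p x≢y λ q → irr (tr p q)
    ...   | inj₂ q = tri> (λ p → irr (tr p q)) x≢y q

  module Order {_≺_ : Rel (Fin n) 0ℓ} (o : IsOrder _≺_) where
    open IsStrictTotalOrder o public using (asym; compare) renaming (trans to ≺-trans; _<?_ to _≺?_)

    irr : ∀ {x} → ¬ x ≺ x
    irr = IsStrictTotalOrder.irrefl o refl

    total : ∀ {x y} → x ≢ y → x ≺ y ⊎ y ≺ x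
    total {x} {y} x≢y with compare x y
    ... | tri< p _ _  = inj₁ p
    ... | tri≈ _ eq _ = ⊥-elim (x≢y eq)
    ... | tri> _ _ q  = inj₂ q

  before-order : ∀ {xs : List (Fin n)} → Unique xs → (∀ x → x ∈ₗ xs) → IsOrder (Before xs)
  before-order u full = mkOrder (before-irrefl u) (before-trans u) (before-total (full _) (full _))

  Flip : Rel (Fin n) 0ℓ → Rel (Fin n) 0ℓ
  Flip _≺_ x y = y ≺ x

  flip-order : ∀ {_≺_} → IsOrder _≺_ → IsOrder (Flip _≺_)
  flip-order o = mkOrder irr (λ p q → ≺-trans q p) (Sum.swap ∘ total)
    where open Order o

  -- The ordinal sum of `R₁` restricted to `A` and `R₂` restricted to the complement of `A`.
  data Join (A : Pred (Fin n) 0ℓ) (R₁ R₂ : Rel (Fin n) 0ℓ) (x y : Fin n) : Set where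
    cross : A x → ¬ A y → Join A R₁ R₂ x y
    left  : A x → A y → R₁ x y → Join A R₁ R₂ x y
    right : ¬ A x → ¬ A y → R₂ x y → Join A R₁ R₂ x y

  join-order : ∀ {A R₁ R₂} → Decidable A → IsOrder R₁ → IsOrder R₂ → IsOrder (Join A R₁ R₂)
  join-order {A} {R₁} {R₂} A? o₁ o₂ = mkOrder irr′ tr total′
    where
    module O₁ = Order o₁
    module O₂ = Order o₂
    irr′ : ∀ {x} → ¬ Join A R₁ R₂ x x
    irr′ (cross a ¬a)  = ¬a a
    irr′ (left _ _ r)  = O₁.irr r
    irr′ (right _ _ r) = O₂.irr r
    tr : Transitive (Join A R₁ R₂)
    tr (cross a ¬b)   (cross b _)    = ⊥-elim (¬b b)
    tr (cross a ¬b)   (left b _ _)   = ⊥-elim (¬b b)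
    tr (cross a _)    (right _ ¬c _) = cross a ¬c
    tr (left a _ _)   (cross _ ¬c)   = cross a ¬c
    tr (left a _ r)   (left _ c s)   = left a c (O₁.≺-trans r s)
    tr (left _ b _)   (right ¬b _ _) = ⊥-elim (¬b b)
    tr (right _ ¬b _) (cross b _)    = ⊥-elim (¬b b)
    tr (right _ ¬b _) (left b _ _)   = ⊥-elim (¬b b)
    tr (right ¬a _ r) (right _ ¬c s) = right ¬a ¬c (O₂.≺-trans r s)
    total′ : ∀ {x y} → x ≢ y → Join A R₁ R₂ x y ⊎ Join A R₁ R₂ y x
    total′ {x} {y} x≢y with A? x | A? y
    ... | yes a | yes b = Sum.map (left a b) (left b a) (O₁.total x≢y)
    ... | yes a | no ¬b = inj₁ (cross a ¬b)
    ... | no ¬a | yes b = inj₂ (cross b ¬a)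
    ... | no ¬a | no ¬b = Sum.map (right ¬a ¬b) (right ¬b ¬a) (O₂.total x≢y)

  Contiguous : Rel (Fin n) 0ℓ → Pred (Fin n) 0ℓ → Set
  Contiguous _≺_ M = ∀ {x y z} → M x → M z → x ≺ y → y ≺ z → M y

  -- The relation `_≺_` with its restriction to `M` exchanged for that of `R`.
  data Replace (M : Pred (Fin n) 0ℓ) (R _≺_ : Rel (Fin n) 0ℓ) (x y : Fin n) : Set where
    inside  : M x → M y → R x y → Replace M R _≺_ x y
    outside : ¬ (M x × M y) → x ≺ y → Replace M R _≺_ x y

  module _ {M : Pred (Fin n) 0ℓ} {_≺_ : Rel (Fin n) 0ℓ} (o : IsOrder _≺_)
           (contiguous : Contiguous _≺_ M) where
    private module O = Order o

    -- If `y` were on the other side of `z`, then `z` would lie between two points of `M`.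
    precedes-all : ∀ {x y z} → M x → M y → ¬ M z → x ≺ z → y ≺ z
    precedes-all {x} {y} {z} mx my ¬mz x≺z with O.compare y z
    ... | tri< p _ _   = p
    ... | tri≈ _ refl _ = ⊥-elim (¬mz my)
    ... | tri> _ _ z≺y = ⊥-elim (¬mz (contiguous mx my x≺z z≺y))

    follows-all : ∀ {x y z} → M x → M y → ¬ M z → z ≺ x → z ≺ y
    follows-all {x} {y} {z} mx my ¬mz z≺x with O.compare z y
    ... | tri< p _ _   = p
    ... | tri≈ _ refl _ = ⊥-elim (¬mz my)
    ... | tri> _ _ y≺z = ⊥-elim (¬mz (contiguous my mx y≺z z≺x))

    -- Contiguity is what the mixed cases of transitivity rest on: a point outside `M` compares in
    -- the same way with all points of `M`.
    replace-order : ∀ {R} → Decidable M → IsOrder R → IsOrder (Replace M R _≺_)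
    replace-order {R} M? oR = mkOrder irr′ tr total′
      where
      module OR = Order oR
      irr′ : ∀ {x} → ¬ Replace M R _≺_ x x
      irr′ (inside _ _ r)  = OR.irr r
      irr′ (outside _ p)   = O.irr p
      tr : Transitive (Replace M R _≺_)
      tr (inside a _ r)  (inside _ c s) = inside a c (OR.≺-trans r s)
      tr (inside a b r)  (outside ¬bc p) =
        outside (λ (_ , c) → ¬bc (b , c)) (precedes-all b a (λ c → ¬bc (b , c)) p)
      tr (outside ¬ab p) (inside b c r) =
        outside (λ (a , _) → ¬ab (a , b)) (follows-all b c (λ a → ¬ab (a , b)) p)
      tr (outside ¬ab p) (outside _ q)  =
        outside (λ (a , c) → ¬ab (a , contiguous a c p q)) (O.≺-trans p q)
      total′ : ∀ {x y} → x ≢ y → Replace M R _≺_ x y ⊎ Replace M R _≺_ y x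
      total′ {x} {y} x≢y with M? x | M? y
      ... | yes a | yes b = Sum.map (inside a b) (inside b a) (OR.total x≢y)
      ... | no ¬a | _     = Sum.map (outside (¬a ∘ proj₁)) (outside (¬a ∘ proj₂)) (O.total x≢y)
      ... | yes _ | no ¬b = Sum.map (outside (¬b ∘ proj₂)) (outside (¬b ∘ proj₁)) (O.total x≢y)

-- Finite graphs

module _ {n : ℕ} where

  subset : ∀ {p} {P : Pred (Fin n) p} → Decidable P → ∃[ S ] (∀ {x} → x ∈ S ⇔ P x)
  subset P? = tabulate (does ∘ P?) , λ {x} → mk⇔
    (λ x∈ → decTrue (P? x) (trans (sym (Vec.lookup∘tabulate _ x)) (Vec.[]=⇒lookup x∈)))
    (λ px → Vec.lookup⇒[]= x _ (trans (Vec.lookup∘tabulate _ x) (dec-true (P? x) px)))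
    where
    decTrue : ∀ {a} {A : Set a} (a? : Dec A) → does a? ≡ true → A
    decTrue (yes a) _ = a

  -- The edge found is the first one of the walk that leaves `P`. The walk up to it is returned as
  -- well, since it places the endpoint `u` in the component of `x`.
  crossing : ∀ {e p} {E : Rel (Fin n) e} {P : Pred (Fin n) p} → Decidable P →
    ∀ {x y} → Star E x y → P x → ¬ P y → ∃[ u ] ∃[ v ] (Star E x u × E u v × P u × ¬ P v)
  crossing P? ε px ¬py = ⊥-elim (¬py px)
  crossing P? (_◅_ {x} {y} e es) px ¬pz with P? y
  ... | no ¬py = x , y , ε , e , px , ¬py
  ... | yes py with u , v , s , r ← crossing P? es py ¬pz = u , v , e ◅ s , r

  abstract
    -- Endpoints of outgoing edges are added one by one, which ends because a finite set cannot grow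
    -- forever. A set without outgoing edges contains every walk that starts in it.
    reachable : ∀ {e} {E : Rel (Fin n) e} → Decidable₂ E → ∀ x → ∃[ S ] (∀ {y} → y ∈ S ⇔ Star E x y)
    reachable {E = E} E? x = grow ⁅ x ⁆ (⊃-wellFounded _) (x∈⁅x⁆ x)
      (λ y∈ → subst (Star E x) (sym (x∈⁅y⁆⇒x≡y x y∈)) ε)
      where
      grow : ∀ S → Acc _⊃_ S → x ∈ S → (∀ {y} → y ∈ S → Star E x y) →
             ∃[ S ] (∀ {y} → y ∈ S ⇔ Star E x y)
      grow S (acc rec) x∈S sound
        with Fin.any? (λ u → Fin.any? (λ v → (u ∈? S) ×-dec ¬? (v ∈? S) ×-dec E? u v))
      ... | yes (u , v , u∈S , v∉S , e) =
        grow (S ∪ ⁅ v ⁆) (rec (p⊆p∪q _ , v , x∈p∪q⁺ (inj₂ (x∈⁅x⁆ v)) , v∉S)) (p⊆p∪q _ x∈S)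
          (λ y∈ → Sum.[ sound
                      , (λ y∈v → subst (Star E x) (sym (x∈⁅y⁆⇒x≡y v y∈v)) (sound u∈S ◅◅ e ◅ ε))
                      ] (x∈p∪q⁻ S _ y∈))
      ... | no ¬edge = S , λ {y} → mk⇔ sound complete
        where
        complete : ∀ {y} → Star E x y → y ∈ S
        complete {y} s with y ∈? S
        ... | yes y∈S = y∈S
        ... | no y∉S with u , v , _ , e , u∈ , v∉ ← crossing (_∈? S) s x∈S y∉S =
          ⊥-elim (¬edge (u , v , u∈ , v∉ , e))

  module _ {e} {E : Rel (Fin n) e} (E-sym : Symmetric E) where

    component : Decidable₂ E → ∀ x → ∃[ S ] (IsComponent E S × x ∈ S)
    component E? x with S , p ← reachable E? x = S , ((x , from p ε) , λ u v u∈ → mk⇔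
        (λ v∈ → Star.reverse E-sym (to p u∈) ◅◅ to p v∈)
        (λ s → from p (to p u∈ ◅◅ s))) , from p ε
      where open Equivalence

    component-⊆ : ∀ {S S′ x} → IsComponent E S → IsComponent E S′ → x ∈ S → x ∈ S′ → S ⊆ S′
    component-⊆ {x = x} (_ , c) (_ , c′) x∈S x∈S′ {y} y∈S =
      Equivalence.from (c′ x y x∈S′) (Equivalence.to (c x y x∈S) y∈S)

    component-≡ : ∀ {S S′ x} → IsComponent E S → IsComponent E S′ → x ∈ S → x ∈ S′ → S ≡ S′
    component-≡ c c′ p p′ = ⊆-antisym (component-⊆ c c′ p p′) (component-⊆ c′ c p′ p)

  _≟ˢ_ : (S S′ : Subset n) → Dec (S ≡ S′)
  _≟ˢ_ = Vec.≡-dec _≟ᵇ_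

  ≢⊤⇒∃∉ : ∀ {S : Subset n} → S ≢ ⊤ → ∃[ x ] x ∉ S
  ≢⊤⇒∃∉ {S} S≢⊤ with Fin.any? (λ x → ¬? (x ∈? S))
  ... | yes p = p
  ... | no ¬p = ⊥-elim (S≢⊤ (⊆-antisym (λ _ → ∈⊤) λ {x} _ →
    decidable-stable (x ∈? S) (λ x∉ → ¬p (x , x∉))))

  ∉⇒≢⊤ : ∀ {S : Subset n} {x} → x ∉ S → S ≢ ⊤
  ∉⇒≢⊤ x∉ refl = x∉ ∈⊤

  ∈X⁺ : ∀ {t : PQTree n} {x} → x ∈ₗ frontier t → x ∈ X⟨ t ⟩
  ∈X⁺ {t} = go (frontier t)
    where
    go : ∀ xs {x} → x ∈ₗ xs → x ∈ ⋃ (List.map ⁅_⁆ xs)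
    go (y ∷ xs) (here refl) = x∈p∪q⁺ (inj₁ (x∈⁅x⁆ y))
    go (y ∷ xs) (there p)   = x∈p∪q⁺ (inj₂ (go xs p))

  ∈X⁻ : ∀ {t : PQTree n} {x} → x ∈ X⟨ t ⟩ → x ∈ₗ frontier t
  ∈X⁻ {t} = go (frontier t)
    where
    go : ∀ xs {x} → x ∈ ⋃ (List.map ⁅_⁆ xs) → x ∈ₗ xs
    go []       p = ⊥-elim (∉⊥ p)
    go (y ∷ xs) p with x∈p∪q⁻ ⁅ y ⁆ _ p
    ... | inj₁ q = here (x∈⁅y⁆⇒x≡y y q)
    ... | inj₂ q = there (go xs q)

  ∁-involutive : (S : Subset n) → ∁ (∁ S) ≡ S
  ∁-involutive S = ⊆-antisym (λ p → x∉∁p⇒x∈p (x∈∁p⇒x∉p p)) (λ p → x∉p⇒x∈∁p (x∈p⇒x∉∁p p))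

-- Compatibility on a set of points, and new compatible orders from old ones.

module _ {c ℓ₁ ℓ₂} (S : DissimilaritySpace c ℓ₁ ℓ₂) where

  open Space S
  open DecTotalOrder values using (module Eq) renaming
    ( refl to ≤-refl; reflexive to ≤-reflexive; trans to ≤-trans; antisym to ≤-antisym
    ; _≟_ to _≈?_; _≤?_ to _≤?_ )
  open DecTotalOrderProperties values using (≰⇒>)
  open MaxOp (Max.maxOperator (DecTotalOrder.totalOrder values)) using (⊔-lub; x≤x⊔y; x≤y⊔x)
  open DecMembership {A = Fin size} Fin._≟_ using () renaming (_∈?_ to _∈ₗ?_)

  private variable
    x y z : Fin size
    t u : PQTree size
    δ ρ v : Value

  sym≤ : d x y ≤ d y x
  sym≤ {x} {y} = ≤-reflexive (d-sym x y)

  swap≤ : ∀ {a b x y} → d a b ≤ d x y → d b a ≤ d y x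
  swap≤ p = ≤-trans sym≤ (≤-trans p sym≤)

  -- The restriction to `Z` lets the notion apply to the leaves of a subtree while the order still
  -- ranges over all points.
  CompatibleOn : Pred (Fin size) 0ℓ → Rel (Fin size) 0ℓ → Set ℓ₂
  CompatibleOn Z _≺_ = ∀ {x y z} → Z x → Z y → Z z → x ≺ y → y ≺ z →
    d x y ≤ d x z × d y z ≤ d x z

  Leaves : PQTree size → Pred (Fin size) 0ℓ
  Leaves t x = x ∈ₗ frontier t

  leaf? : ∀ t → Decidable (Leaves t)
  leaf? t x = x ∈ₗ? frontier t

  compatible-split : ∀ {Z R} → Compatible R → CompatibleOn Z R
  compatible-split comp {x} {y} {z} _ _ _ p q =
    ≤-trans (x≤x⊔y (d x y) (d y z)) m , ≤-trans (x≤y⊔x (d x y) (d y z)) m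
    where m = comp x y z p q

  compatible-merge : ∀ {Z R} → (∀ x → Z x) → CompatibleOn Z R → Compatible R
  compatible-merge full comp x y z p q with a , b ← comp (full x) (full y) (full z) p q = ⊔-lub a b

  flip-compatible : ∀ {Z R} → CompatibleOn Z R → CompatibleOn Z (Flip R)
  flip-compatible comp zx zy zz p q with a , b ← comp zz zy zx q p = swap≤ b , swap≤ a

  -- A triple on one side is handled by the order of that side. In any other increasing triple the
  -- cut separates the two extreme points, whose distance is then at least the upper bound `δ`.
  join-compatible : ∀ {Z A R₁ R₂} →
    (∀ {x y} → Z x → Z y → d x y ≤ δ) →
    (∀ {x y} → Z x → Z y → A x → ¬ A y → δ ≤ d x y) →
    CompatibleOn Z R₁ → CompatibleOn Z R₂ → CompatibleOn Z (Join A R₁ R₂)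
  join-compatible bd cut c₁ c₂ zx zy zz (cross a ¬b)   (cross b _)    = ⊥-elim (¬b b)
  join-compatible bd cut c₁ c₂ zx zy zz (cross a ¬b)   (left b _ _)   = ⊥-elim (¬b b)
  join-compatible bd cut c₁ c₂ zx zy zz (cross a _)    (right _ ¬c _) =
    ≤-trans (bd zx zy) (cut zx zz a ¬c) , ≤-trans (bd zy zz) (cut zx zz a ¬c)
  join-compatible bd cut c₁ c₂ zx zy zz (left a _ _)   (cross _ ¬c)   =
    ≤-trans (bd zx zy) (cut zx zz a ¬c) , ≤-trans (bd zy zz) (cut zx zz a ¬c)
  join-compatible bd cut c₁ c₂ zx zy zz (left _ _ r)   (left _ _ s)   = c₁ zx zy zz r s
  join-compatible bd cut c₁ c₂ zx zy zz (left _ b _)   (right ¬b _ _) = ⊥-elim (¬b b)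
  join-compatible bd cut c₁ c₂ zx zy zz (right _ ¬b _) (cross b _)    = ⊥-elim (¬b b)
  join-compatible bd cut c₁ c₂ zx zy zz (right _ ¬b _) (left b _ _)   = ⊥-elim (¬b b)
  join-compatible bd cut c₁ c₂ zx zy zz (right _ _ r)  (right _ _ s)  = c₂ zx zy zz r s

  -- One inequality is enough: exchanging `x` and `y` gives the other.
  ModuleOn : Pred (Fin size) 0ℓ → Set ℓ₂
  ModuleOn M = ∀ {z x y} → ¬ M z → M x → M y → d z x ≤ d z y

  -- The critical triples have two neighbouring points in `M` and the third outside. The third point
  -- is equally far from both and on the same side of both in `_≺_`. So, whichever of the two comes
  -- first in `_≺_`, compatibility of `_≺_` bounds their distance.
  replace-compatible : ∀ {Z M R _≺_} → Decidable M → IsOrder _≺_ → Contiguous _≺_ M → ModuleOn M →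
    CompatibleOn M R → CompatibleOn Z _≺_ → CompatibleOn Z (Replace M R _≺_)
  replace-compatible {Z} {M} {R} {_≺_} M? o cont mod cR c≺ {x} {y} {z} = go
    where
    open Order o
    go : Z x → Z y → Z z → Replace M R _≺_ x y → Replace M R _≺_ y z → d x y ≤ d x z × d y z ≤ d x z
    go zx zy zz (inside a b r) (inside _ c s) = cR a b c r s
    go zx zy zz (inside a b r) (outside ¬bc p) = near , swap≤ (mod ¬c b a)
      where
      ¬c : ¬ M z
      ¬c mc = ¬bc (b , mc)
      x≺z : x ≺ z
      x≺z = precedes-all o cont b a ¬c p
      near : d x y ≤ d x z
      near with compare x y
      ... | tri< x≺y _ _  = proj₁ (c≺ zx zy zz x≺y p)
      ... | tri≈ _ refl _ = ≤-trans (≤-reflexive (d-refl x)) (0-min _)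
      ... | tri> _ _ y≺x  = ≤-trans (≤-trans sym≤ (proj₁ (c≺ zy zx zz y≺x x≺z))) (swap≤ (mod ¬c b a))
    go zx zy zz (outside ¬ab p) (inside b c s) = mod ¬a b c , near
      where
      ¬a : ¬ M x
      ¬a ma = ¬ab (ma , b)
      x≺z : x ≺ z
      x≺z = follows-all o cont b c ¬a p
      near : d y z ≤ d x z
      near with compare y z
      ... | tri< y≺z _ _  = proj₂ (c≺ zx zy zz p y≺z)
      ... | tri≈ _ refl _ = ≤-trans (≤-reflexive (d-refl y)) (0-min _)
      ... | tri> _ _ z≺y  = ≤-trans (≤-trans sym≤ (proj₂ (c≺ zx zz zy x≺z z≺y))) (mod ¬a b c)
    go zx zy zz (outside ¬ab p) (outside ¬bc q) = c≺ zx zy zz p q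

  -- What the arguments use about a subtree: elementary operations keep its leaf order compatible,
  -- and every compatible order of its leaves comes from an equivalent tree. The order `_≺_` extends
  -- the leaf order to all points. The property holds at the root and passes to the children of a
  -- Q-root.
  record Good (t : PQTree size) : Set (lsuc 0ℓ ⊔ ℓ₂) where
    field
      unique      : Unique (frontier t)
      _≺_         : Rel (Fin size) 0ℓ
      order       : IsOrder _≺_
      base        : LeafOrder t ⇒ _≺_
      compatible  : CompatibleOn (Leaves t) _≺_
      step        : ∀ {u} → t ⟶ u → CompatibleOn (Leaves t) (LeafOrder u)
      realize     : ∀ {R} → IsOrder R → CompatibleOn (Leaves t) R → ∃[ u ] (t ≈ᵀ u × LeafOrder u ⇒ R)

  module _ (T : PQTree size) (isPQ : IsPQTreeOfSpace T) where

    all-leaves : ∀ x → x ∈ₗ frontier T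
    all-leaves x = ∈-resp-↭ (↭-sym (proj₁ isPQ)) (∈-allFin x)

    private
      leafOrder-order : T ≈ᵀ u → IsOrder (LeafOrder u)
      leafOrder-order s = before-order
        (unique-↭ (≈ᵀ-frontier s) (unique-↭ (↭-sym (proj₁ isPQ)) (Unique.allFin⁺ size)))
        λ x → ∈-resp-↭ (≈ᵀ-frontier s) (all-leaves x)

      leafOrder-compatible : T ≈ᵀ u → Compatible (LeafOrder u)
      leafOrder-compatible {u} s = Equivalence.from (proj₂ isPQ (LeafOrder u) (leafOrder-order s))
        (u , s , λ x y → mk⇔ id id)

    good-root : Good T
    good-root = record
      { unique     = unique-↭ (↭-sym (proj₁ isPQ)) (Unique.allFin⁺ size)
      ; _≺_        = LeafOrder T
      ; order      = leafOrder-order ε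
      ; base       = id
      ; compatible = compatible-split (leafOrder-compatible ε)
      ; step       = λ s → compatible-split (leafOrder-compatible (s ◅ ε))
      ; realize    = λ {R} o comp →
          let u , s , iff = Equivalence.to (proj₂ isPQ R o) (compatible-merge all-leaves comp)
          in u , s , λ {x} {y} → Equivalence.from (iff x y)
      }

  -- Q-nodes: rigidity of the order of the children.

  module GoodQ {k} {ts : Vec (PQTree size) (3 + k)} (good : Good (Q ts)) where

    open Good good

    private
      Block : Fin (3 + k) → Pred (Fin size) 0ℓ
      Block i = Leaves (lookup ts i)

      ∈Q : ∀ {i} → Block i x → Leaves (Q ts) x
      ∈Q {i = i} = ∈-frontiers⁺ ts i

    -- Either order lists the blocks forwards or backwards.
    agree : ∀ {R R′} → IsOrder R → CompatibleOn (Leaves (Q ts)) R →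
            IsOrder R′ → CompatibleOn (Leaves (Q ts)) R′ →
      (∀ {i j x y} → i ≢ j → Block i x → Block j y → R x y → R′ x y) ⊎
      (∀ {i j x y} → i ≢ j → Block i x → Block j y → R x y → R′ y x)
    agree {R} {R′} o c o′ c′ with realize o c | realize o′ c′
    ... | u , s , f | u′ , s′ , f′ with Q-order s | Q-order s′
    ... | inj₁ g | inj₁ g′ = inj₁ λ {i} {j} i≢j p q r → case Fin.<-cmp i j of λ where
        (tri< i<j _ _) → f′ (g′ i<j p q)
        (tri≈ _ e _)   → ⊥-elim (i≢j e)
        (tri> _ _ j<i) → ⊥-elim (Order.asym o r (f (g j<i q p)))
    ... | inj₁ g | inj₂ g′ = inj₂ λ {i} {j} i≢j p q r → case Fin.<-cmp i j of λ where
        (tri< i<j _ _) → f′ (g′ i<j p q)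
        (tri≈ _ e _)   → ⊥-elim (i≢j e)
        (tri> _ _ j<i) → ⊥-elim (Order.asym o r (f (g j<i q p)))
    ... | inj₂ g | inj₁ g′ = inj₂ λ {i} {j} i≢j p q r → case Fin.<-cmp i j of λ where
        (tri< i<j _ _) → ⊥-elim (Order.asym o r (f (g i<j p q)))
        (tri≈ _ e _)   → ⊥-elim (i≢j e)
        (tri> _ _ j<i) → f′ (g′ j<i q p)
    ... | inj₂ g | inj₂ g′ = inj₁ λ {i} {j} i≢j p q r → case Fin.<-cmp i j of λ where
        (tri< i<j _ _) → ⊥-elim (Order.asym o r (f (g i<j p q)))
        (tri≈ _ e _)   → ⊥-elim (i≢j e)
        (tri> _ _ j<i) → f′ (g′ j<i q p)

    -- Since `x` and `y` are exchanged, `agree` forces all pairs from different blocks to be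
    -- exchanged. But `w` is outside the block of `x` or outside that of `y`, and keeps its side of
    -- both points.
    rigid : ∀ {R R′} → IsOrder R → CompatibleOn (Leaves (Q ts)) R →
            IsOrder R′ → CompatibleOn (Leaves (Q ts)) R′ →
      ∀ {i j x y w} → i ≢ j → Block i x → Block j y → Leaves (Q ts) w →
      R x y → R′ y x →
      (R x w × R′ x w) ⊎ (R w x × R′ w x) → (R y w × R′ y w) ⊎ (R w y × R′ w y) → ⊥
    rigid o c o′ c′ {i} {j} i≢j x∈ y∈ w∈ xy yx xw yw with agree o c o′ c′
    ... | inj₁ f = Order.asym o′ (f i≢j x∈ y∈ xy) yx
    ... | inj₂ f with h , w∈h ← ∈-frontiers⁻ ts w∈ | h Fin.≟ i
    ...   | no h≢i = Sum.[ (λ (p , q) → Order.asym o′ q (f (h≢i ∘ sym) x∈ w∈h p))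
                         , (λ (p , q) → Order.asym o′ q (f h≢i w∈h x∈ p)) ] xw
    ...   | yes refl = Sum.[ (λ (p , q) → Order.asym o′ q (f (i≢j ∘ sym) y∈ w∈h p))
                           , (λ (p , q) → Order.asym o′ q (f i≢j w∈h y∈ p)) ] yw

    -- If all distances across a cut (A, ¬A) had the maximal value δ, then either
    -- side could be reversed independently of the other, so that each side would lie
    -- in one block; but there are at least three blocks.
    no-cut : ∀ {A} → Decidable A →
      (∀ {x y} → Leaves (Q ts) x → Leaves (Q ts) y → d x y ≤ δ) →
      (∀ {x y} → Leaves (Q ts) x → Leaves (Q ts) y → A x → ¬ A y → δ ≤ d x y) →
      Leaves (Q ts) x → A x → Leaves (Q ts) y → ¬ A y → ⊥
    no-cut {x = a} {y = b} {A} A? bd cut a∈ Aa b∈ ¬Ab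
      with x₀ , x₀∈ ← someLeaf (lookup ts zero)
         | x₁ , x₁∈ ← someLeaf (lookup ts (suc zero))
         | x₂ , x₂∈ ← someLeaf (lookup ts (suc (suc zero))) = split (A? x₀) (A? x₁) (A? x₂)
      where
      o₀ = join-order A? order order
      c₀ = join-compatible bd cut compatible compatible
      -- The two orders compared differ by the reversal of the side `A`; the point `b`, beyond the
      -- cut, follows `x` and `y` in both. `right-block` is the mirror case.
      left-block : ∀ {i j x y} → i ≢ j → Block i x → Block j y → A x → A y → x ≺ y → ⊥
      left-block i≢j x∈ y∈ Ax Ay x≺y = rigid o₀ c₀
        (join-order A? (flip-order order) order) (join-compatible bd cut (flip-compatible compatible) compatible)
        i≢j x∈ y∈ b∈ (left Ax Ay x≺y) (left Ay Ax x≺y)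
        (inj₁ (cross Ax ¬Ab , cross Ax ¬Ab)) (inj₁ (cross Ay ¬Ab , cross Ay ¬Ab))
      right-block : ∀ {i j x y} → i ≢ j → Block i x → Block j y → ¬ A x → ¬ A y → x ≺ y → ⊥
      right-block i≢j x∈ y∈ ¬Ax ¬Ay x≺y = rigid o₀ c₀
        (join-order A? order (flip-order order)) (join-compatible bd cut compatible (flip-compatible compatible))
        i≢j x∈ y∈ a∈ (right ¬Ax ¬Ay x≺y) (right ¬Ay ¬Ax x≺y)
        (inj₂ (cross Aa ¬Ax , cross Aa ¬Ax)) (inj₂ (cross Aa ¬Ay , cross Aa ¬Ay))
      blocks : ∀ {i j x y} → i Fin.< j → Block i x → Block j y → x ≺ y
      blocks i<j p q = base (before-blocks ts i<j p q)
      x₀≺x₁ = blocks {zero} {suc zero} (ℕ.s≤s ℕ.z≤n) x₀∈ x₁∈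
      x₀≺x₂ = blocks {zero} {suc (suc zero)} (ℕ.s≤s ℕ.z≤n) x₀∈ x₂∈
      x₁≺x₂ = blocks {suc zero} {suc (suc zero)} (ℕ.s≤s (ℕ.s≤s ℕ.z≤n)) x₁∈ x₂∈
      -- Of three leaves from different blocks, two are on the same side.
      split : Dec (A x₀) → Dec (A x₁) → Dec (A x₂) → ⊥
      split (yes p) (yes q) _       = left-block (λ ()) x₀∈ x₁∈ p q x₀≺x₁
      split (yes p) (no _)  (yes r) = left-block (λ ()) x₀∈ x₂∈ p r x₀≺x₂
      split (yes _) (no q)  (no r)  = right-block (λ ()) x₁∈ x₂∈ q r x₁≺x₂
      split (no _)  (yes q) (yes r) = left-block (λ ()) x₁∈ x₂∈ q r x₁≺x₂
      split (no p)  (yes _) (no r)  = right-block (λ ()) x₀∈ x₂∈ p r x₀≺x₂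
      split (no p)  (no q)  _       = right-block (λ ()) x₀∈ x₁∈ p q x₀≺x₁

    private
      inner : ∀ {i} → Before (frontier (lookup ts i)) x y → x ≺ y
      inner {i = i} b = base (Sublist.⊆-trans b (block-⊆ ts i))

      outer : ∀ {i j} → i Fin.< j → Block i x → Block j y → x ≺ y
      outer i<j p q = base (before-blocks ts i<j p q)

      inner-reversed : ∀ {i} → Before (frontier (lookup ts i)) x y → LeafOrder (Q (reverse ts)) x y
      inner-reversed {i = i} b = Sublist.⊆-trans b
        (subst (λ v → frontier v Sublist.⊆ _) (lookup-reverse ts i) (block-⊆ (reverse ts) (opposite i)))

      outer-reversed : ∀ {i j} → i Fin.< j → Block i x → Block j y → LeafOrder (Q (reverse ts)) y x
      outer-reversed {x} {y} {i} {j} i<j p q = before-blocks (reverse ts) (opposite-< i<j)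
        (subst (λ v → Leaves v y) (sym (lookup-reverse ts j)) q)
        (subst (λ v → Leaves v x) (sym (lookup-reverse ts i)) p)

    -- Reversing the order of the children is, up to reversal of the whole order, the
    -- same as reversing the order within each block.
    block-module : (∀ x → Leaves (Q ts) x) → ∀ i → ModuleOn (Block i)
    block-module full i {z} {x} {y} z∉ x∈ y∈ with j , z∈j ← ∈-frontiers⁻ ts (full z) | x Fin.≟ y
    ... | yes refl = ≤-refl
    ... | no x≢y with before-total x∈ y∈ x≢y | Fin.<-cmp i j
    ...   | _      | tri≈ _ refl _ = ⊥-elim (z∉ z∈j)
    -- In this case and the next, `x` lies between `z` and `y` in the leaf order; in the last two it
    -- does so after `flip`.
    ...   | inj₁ b | tri> _ _ j<i  =
      proj₁ (compatible (full z) (full x) (full y) (outer j<i z∈j x∈) (inner b))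
    ...   | inj₂ b | tri< i<j _ _  =
      swap≤ (proj₂ (compatible (full y) (full x) (full z) (inner b) (outer i<j x∈ z∈j)))
    ...   | inj₁ b | tri< i<j _ _  =
      proj₁ (step (flip ts) (full z) (full x) (full y) (outer-reversed i<j x∈ z∈j) (inner-reversed b))
    ...   | inj₂ b | tri> _ _ j<i  =
      swap≤ (proj₂ (step (flip ts) (full y) (full x) (full z) (inner-reversed b) (outer-reversed j<i z∈j x∈)))

    block-contiguous : (∀ x → Leaves (Q ts) x) → ∀ i → Contiguous _≺_ (Block i)
    block-contiguous full i {x} {y} {z} x∈ z∈ x≺y y≺z with j , y∈j ← ∈-frontiers⁻ ts (full y) | Fin.<-cmp i j
    ... | tri< i<j _ _  = ⊥-elim (Order.asym order y≺z (base (before-blocks ts i<j z∈ y∈j)))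
    ... | tri≈ _ refl _ = y∈j
    ... | tri> _ _ j<i  = ⊥-elim (Order.asym order x≺y (base (before-blocks ts j<i y∈j x∈)))

    -- An order of the block is put into `_≺_` in place of the old order of the block, which is a
    -- contiguous mmodule. A tree realizing the result is then cut down to the child.
    good-child : (∀ x → Leaves (Q ts) x) → ∀ i → Good (lookup ts i)
    good-child full i = record
      { unique     = block-unique-frontier
      ; _≺_        = _≺_
      ; order      = order
      ; base       = λ b → base (Sublist.⊆-trans b (block-⊆ ts i))
      ; compatible = λ p q r → compatible (∈Q p) (∈Q q) (∈Q r)
      ; step       = λ {u} s p q r b b′ → step (belowQ ts i s) (∈Q p) (∈Q q) (∈Q r) (lift b) (lift b′)
      ; realize    = λ {R} o comp →
          let u , s , f = realize (replace-order order cont (leaf? (lookup ts i)) o)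
                            (replace-compatible (leaf? (lookup ts i)) order cont (block-module full i) comp compatible)
              w , s′ , g = Q-child s i
          in w , s′ , λ {x} {y} b → unreplace
               (∈-resp-↭ (↭-sym (≈ᵀ-frontier s′)) (before-∈ˡ b))
               (∈-resp-↭ (↭-sym (≈ᵀ-frontier s′)) (before-∈ʳ b)) (f (g b))
      }
      where
      cont : Contiguous _≺_ (Block i)
      cont = block-contiguous full i
      block-unique-frontier : Unique (frontier (lookup ts i))
      block-unique-frontier = unique-⊆ (block-⊆ ts i) unique
      lift : ∀ {u} → LeafOrder u ⇒ LeafOrder (Q (ts [ i ]≔ u))
      lift {u} b = Sublist.⊆-trans b
        (subst (λ v → frontier v Sublist.⊆ frontiers (ts [ i ]≔ u)) (Vec.lookup∘update i ts u) (block-⊆ (ts [ i ]≔ u) i))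
      unreplace : ∀ {R x y} → Block i x → Block i y → Replace (Block i) R _≺_ x y → R x y
      unreplace p q (inside _ _ r)  = r
      unreplace p q (outside ¬pq _) = ⊥-elim (¬pq (p , q))

    -- Reversing `_≺_` on `M` alone exchanges `x` and `y` and leaves the position of `w` relative to
    -- both unchanged, which `rigid` excludes when the blocks differ.
    module-in-block : ∀ {M} → Decidable M → (∀ x → Leaves (Q ts) x) → Contiguous _≺_ M → ModuleOn M →
      ∀ {i j x y w} → Block i x → Block j y → M x → M y → ¬ M w → i ≡ j
    module-in-block {M} M? full cont mod {i} {j} {x} {y} {w} x∈ y∈ Mx My ¬Mw with i Fin.≟ j
    ... | yes i≡j = i≡j
    ... | no i≢j  = ⊥-elim (Sum.[ reverse-M i≢j x∈ y∈ Mx My , reverse-M (i≢j ∘ sym) y∈ x∈ My Mx ]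
                             (Order.total order λ { refl → i≢j (block-unique ts unique x∈ y∈) }))
      where
      compare-w : ∀ {x} → M x → (x ≺ w × Replace M (Flip _≺_) _≺_ x w) ⊎ (w ≺ x × Replace M (Flip _≺_) _≺_ w x)
      compare-w Mx = Sum.map (λ p → p , outside (¬Mw ∘ proj₂) p) (λ p → p , outside (¬Mw ∘ proj₁) p)
        (Order.total order λ { refl → ¬Mw Mx })
      reverse-M : ∀ {i j x y} → i ≢ j → Block i x → Block j y → M x → M y → x ≺ y → ⊥
      reverse-M i≢j x∈ y∈ Mx My x≺y = rigid order compatible
        (replace-order order cont M? (flip-order order))
        (replace-compatible M? order cont mod (flip-compatible (λ _ _ _ → compatible (full _) (full _) (full _))) compatible)
        i≢j x∈ y∈ (full w) x≺y (inside My Mx x≺y) (compare-w Mx) (compare-w My)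

  -- P-nodes: the distance between different children.

  module GoodP {k} {ts : Vec (PQTree size) (2 + k)} (good : Good (P ts)) where

    open Good good

    private
      Block : Fin (2 + k) → Pred (Fin size) 0ℓ
      Block i = Leaves (lookup ts i)

      ∈P : ∀ {i} → Block i x → Leaves (P ts) x
      ∈P {i = i} = ∈-frontiers⁺ ts i

      -- With the blocks `i` and `j` moved to the front, `e` comes after `a` and `b`.
      triple : ∀ {i j a b e} → i ≢ j → Block i a → Block j b → Leaves (P ts) e → ¬ Block i e → ¬ Block j e →
        d a b ≤ d a e
      triple {i} {j} i≢j a∈ b∈ e∈ e∉i e∉j = locate (∈-frontiers⁻ us (∈-resp-↭ (⟶-frontier (permute p)) e∈))
        where
        us = lookup ts i ∷ lookup ts j ∷ proj₁ (bring-two-front ts i≢j)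
        p : toList ts ↭ toList us
        p = proj₂ (bring-two-front ts i≢j)
        locate : ∃[ h ] Leaves (lookup us h) _ → _
        locate (zero , q)        = ⊥-elim (e∉i q)
        locate (suc zero , q)    = ⊥-elim (e∉j q)
        locate (suc (suc h) , q) = proj₁ (step (permute p) (∈P a∈) (∈P b∈) e∈
          (before-blocks us {zero} {suc zero} (ℕ.s≤s ℕ.z≤n) a∈ b∈)
          (before-blocks us {suc zero} {suc (suc h)} (ℕ.s≤s (ℕ.s≤s ℕ.z≤n)) b∈ q))

      -- Block `i` is placed directly before block `j`; in `pair′` it is placed directly after.
      pair : ∀ {i j a b b′} → i ≢ j → Block i a → Block j b → Block j b′ → Before (frontier (lookup ts j)) b b′ →
        d a b ≤ d a b′ × d b b′ ≤ d a b′
      pair {i} {j} i≢j a∈ b∈ b′∈ b<b′ = step (permute (proj₂ (bring-two-front ts i≢j))) (∈P a∈) (∈P b∈) (∈P b′∈)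
        (before-blocks us {zero} {suc zero} (ℕ.s≤s ℕ.z≤n) a∈ b∈) (Sublist.⊆-trans b<b′ (block-⊆ us (suc zero)))
        where us = lookup ts i ∷ lookup ts j ∷ proj₁ (bring-two-front ts i≢j)

      pair′ : ∀ {i j a b b′} → i ≢ j → Block i a → Block j b → Block j b′ → Before (frontier (lookup ts j)) b b′ →
        d b b′ ≤ d b a × d b′ a ≤ d b a
      pair′ {i} {j} i≢j a∈ b∈ b′∈ b<b′ = step (permute (proj₂ (bring-two-front ts (i≢j ∘ sym)))) (∈P b∈) (∈P b′∈) (∈P a∈)
        (Sublist.⊆-trans b<b′ (block-⊆ us zero)) (before-blocks us {zero} {suc zero} (ℕ.s≤s ℕ.z≤n) b′∈ a∈)
        where us = lookup ts j ∷ lookup ts i ∷ proj₁ (bring-two-front ts (i≢j ∘ sym))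

      -- The block of `a` can be put on either side of block `j`, so either of `b` and `b′` can be
      -- the nearer one. By symmetry the two distances are equal.
      far : ∀ {i j a b b′} → i ≢ j → Block i a → Block j b → Block j b′ → d a b ≤ d a b′
      far {b = b} {b′} i≢j a∈ b∈ b′∈ with b Fin.≟ b′
      ... | yes refl = ≤-refl
      ... | no b≢b′ with before-total b∈ b′∈ b≢b′
      ...   | inj₁ q = proj₁ (pair i≢j a∈ b∈ b′∈ q)
      ...   | inj₂ q = swap≤ (proj₂ (pair′ i≢j a∈ b′∈ b∈ q))

      near : ∀ {i j a b b′} → i ≢ j → Block i a → Block j b → Block j b′ → d b b′ ≤ d a b′
      near {b = b} {b′} i≢j a∈ b∈ b′∈ with b Fin.≟ b′
      ... | yes refl = ≤-trans (≤-reflexive (d-refl b)) (0-min _)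
      ... | no b≢b′ with before-total b∈ b′∈ b≢b′
      ...   | inj₁ q = proj₂ (pair i≢j a∈ b∈ b′∈ q)
      ...   | inj₂ q = swap≤ (proj₁ (pair′ i≢j a∈ b′∈ b∈ q))

      from-point : ∀ {i j j′ a b b′} → i ≢ j → i ≢ j′ → Block i a → Block j b → Block j′ b′ → d a b ≤ d a b′
      from-point {j = j} {j′} i≢j i≢j′ a∈ b∈ b′∈ with j Fin.≟ j′
      ... | yes refl = far i≢j a∈ b∈ b′∈
      ... | no j≢j′  = triple i≢j a∈ b∈ (∈P b′∈)
        (λ q → i≢j′ (block-unique ts unique q b′∈)) (λ q → j≢j′ (block-unique ts unique q b′∈))

      -- The pair `a`, `b` is moved to `a′`, `b′` one point at a time, passing through `a′`, `b` if
      -- the first points share a block and through `a`, `a′` if not.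
      across : ∀ {i j i′ j′ a b a′ b′} → i ≢ j → i′ ≢ j′ →
        Block i a → Block j b → Block i′ a′ → Block j′ b′ → d a b ≤ d a′ b′
      across {i} {i′ = i′} i≢j i′≢j′ a∈ b∈ a′∈ b′∈ with i Fin.≟ i′
      ... | yes refl = ≤-trans (swap≤ (far (i≢j ∘ sym) b∈ a∈ a′∈)) (from-point i≢j i′≢j′ a′∈ b∈ b′∈)
      ... | no i≢i′  = ≤-trans (≤-trans (from-point i≢j i≢i′ a∈ b∈ a′∈) sym≤)
                               (from-point (i≢i′ ∘ sym) i′≢j′ a′∈ a∈ b′∈)

      another : (i : Fin (2 + k)) → ∃[ j ] j ≢ i
      another zero    = suc zero , λ ()
      another (suc i) = zero , λ ()

    -- For `x` and `y` in one block, a leaf of another block is at least as far from `y` as `x` is.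
    across-max : ∀ {i j a b} → Leaves (P ts) x → Leaves (P ts) y → i ≢ j → Block i a → Block j b → d x y ≤ d a b
    across-max x∈ y∈ i≢j a∈ b∈ with h , x∈h ← ∈-frontiers⁻ ts x∈ | h′ , y∈h′ ← ∈-frontiers⁻ ts y∈ | h Fin.≟ h′
    ... | no h≢h′ = across h≢h′ i≢j x∈h y∈h′ a∈ b∈
    ... | yes refl with l , l≢h ← another h with e , e∈ ← someLeaf (lookup ts l) =
      ≤-trans (near l≢h e∈ x∈h y∈h′) (across l≢h i≢j e∈ y∈h′ a∈ b∈)

    -- Otherwise the other blocks could be placed between the two parts of the block.
    no-cut : ∀ {A} → Decidable A →
      (∀ {x y} → Leaves (P ts) x → Leaves (P ts) y → d x y ≤ δ) →
      (∀ {i j x y} → i ≢ j → Block i x → Block j y → δ ≤ d x y) →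
      ∀ i → (∀ {x y} → Block i x → Block i y → A x → ¬ A y → δ ≤ d x y) →
      Block i x → A x → Block i y → ¬ A y → ⊥
    no-cut {δ = δ} {x = a} {y = b} {A} A? bd cut i cutᵢ a∈ Aa b∈ ¬Ab =
      contradict (realize split-order split-compatible)
      where
      Part : Pred (Fin size) 0ℓ
      Part x = Block i x × A x
      inBlock? = leaf? (lookup ts i)
      part? : Decidable Part
      part? x = inBlock? x ×-dec A? x
      -- In the order to be realized, the points of block `i` in `A` come first, then everything
      -- outside block `i`, then the remaining points of block `i`.
      Rest = Join (λ x → ¬ Block i x) _≺_ _≺_
      cut′ : ∀ {x y} → Leaves (P ts) x → Leaves (P ts) y → Block i x → ¬ Block i y → δ ≤ d x y
      cut′ x∈ y∈ x∈i y∉i with j , y∈j ← ∈-frontiers⁻ ts y∈ = cut (λ { refl → y∉i y∈j }) x∈i y∈j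
      split-order : IsOrder (Join Part _≺_ Rest)
      split-order = join-order part? order (join-order (¬? ∘ inBlock?) order order)
      cut-part : ∀ {x y} → Leaves (P ts) x → Leaves (P ts) y → Part x → ¬ Part y → δ ≤ d x y
      cut-part {x} {y} x∈ y∈ (x∈i , Ax) ¬py with inBlock? y
      ... | yes y∈i = cutᵢ x∈i y∈i Ax (λ Ay → ¬py (y∈i , Ay))
      ... | no y∉i  = cut′ x∈ y∈ x∈i y∉i
      split-compatible : CompatibleOn (Leaves (P ts)) (Join Part _≺_ Rest)
      split-compatible = join-compatible bd cut-part compatible
        (join-compatible bd
          (λ {x} {y} x∈ y∈ x∉i ¬y∉i →
            ≤-trans (cut′ y∈ x∈ (decidable-stable (inBlock? y) ¬y∉i) x∉i) sym≤)
          compatible compatible)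
      l = proj₁ (another i)
      w = proj₁ (someLeaf (lookup ts l))
      w∈l : Block l w
      w∈l = proj₂ (someLeaf (lookup ts l))
      w∉i : ¬ Block i w
      w∉i w∈i = proj₂ (another i) (block-unique ts unique w∈l w∈i)
      contradict : ∃[ u ] (P ts ≈ᵀ u × LeafOrder u ⇒ Join Part _≺_ Rest) → ⊥
      -- In that order `w` is after `a` and before `b`, yet an equivalent tree keeps all of block
      -- `i` on one side of `w`.
      contradict (u , s , f) with P-contiguous s i (∈P w∈l) w∉i
      ... | inj₁ g = Order.asym split-order (f (g b∈))
              (right (w∉i ∘ proj₁) (¬Ab ∘ proj₂) (cross w∉i (λ b∉i → b∉i b∈)))
      ... | inj₂ g = Order.asym split-order (f (g a∈)) (cross (a∈ , Aa) (w∉i ∘ proj₁))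

  -- Diameters.

  max-foldr-≤ : ∀ {vs} → (∀ {u} → u ∈ₗ vs → u ≤ v) → foldr max 0# vs ≤ v
  max-foldr-≤ {vs = []}     h = 0-min _
  max-foldr-≤ {vs = u ∷ vs} h = ⊔-lub (h (here refl)) (max-foldr-≤ (h ∘ there))

  ≤-max-foldr : ∀ {vs} → v ∈ₗ vs → v ≤ foldr max 0# vs
  ≤-max-foldr {vs = u ∷ vs} (here refl) = x≤x⊔y u _
  ≤-max-foldr {vs = u ∷ vs} (there p)   = ≤-trans (≤-max-foldr p) (x≤y⊔x u _)

  diam-≤ : ∀ {M} → (∀ {x y} → x ∈ M → y ∈ M → d x y ≤ v) → diam M ≤ v
  diam-≤ {v} {M} h = max-foldr-≤ λ p →
    let x , y , x∈ , y∈ , eq = ∈-cartesianProductWith⁻ d _ _ p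
    in subst (_≤ v) (sym eq) (h (proj₂ (∈-filter⁻ (_∈? M) {xs = allFin size} x∈))
                               (proj₂ (∈-filter⁻ (_∈? M) {xs = allFin size} y∈)))

  ≤-diam : ∀ {M} → x ∈ M → y ∈ M → d x y ≤ diam M
  ≤-diam {M = M} x∈ y∈ = ≤-max-foldr
    (∈-cartesianProductWith⁺ d (∈-filter⁺ (_∈? M) (∈-allFin _) x∈) (∈-filter⁺ (_∈? M) (∈-allFin _) y∈))

  -- Components at `ρ` and the maximal mmodules of a non-connected space.

  Gᶜ-sym : Symmetric (Gᶜ ρ)
  Gᶜ-sym (x≢y , x≉y) = x≢y ∘ sym , x≉y ∘ Eq.trans (d-sym _ _)

  Gᶜ? : ∀ ρ → Decidable₂ (Gᶜ ρ)
  Gᶜ? ρ x y = ¬? (x Fin.≟ y) ×-dec ¬? (d x y ≈? ρ)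

  componentOf : ∀ ρ x → ∃[ C ] (IsMmoduleAt ρ C × x ∈ C)
  componentOf ρ = component Gᶜ-sym (Gᶜ? ρ)

  -- Any other distance would be an edge of `Gᶜ ρ` out of the component.
  leaving : ∀ {C} → IsMmoduleAt ρ C → x ∈ C → y ∉ C → d x y ≈ ρ
  leaving {ρ} {x} {y} (_ , c) x∈ y∉ = decidable-stable (d x y ≈? ρ) λ x≉y →
    y∉ (Equivalence.from (c x y x∈) (((λ { refl → y∉ x∈ }) , x≉y) ◅ ε))

  connected-in : ∀ {C} → IsMmoduleAt ρ C → x ∈ C → y ∈ C → Star (Gᶜ ρ) x y
  connected-in {x = x} {y} (_ , c) x∈ y∈ = Equivalence.to (c x y x∈) y∈

  reached : ∀ {C} → IsMmoduleAt ρ C → x ∈ C → Star (Gᶜ ρ) x y → y ∈ C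
  reached {x = x} {y} (_ , c) x∈ s = Equivalence.from (c x y x∈) s

  component-proper : NonConnectedSpace ρ → ∀ {C} → IsMmoduleAt ρ C → ∃[ w ] w ∉ C
  component-proper nc {C} comp = ≢⊤⇒∃∉ λ { refl → nc λ x y → connected-in comp ∈⊤ ∈⊤ }

  -- Let `C` be the component of `z`. If `M` meets `C` and also has a point `w` outside, a walk in
  -- `C` from `z` enters `M` by an edge from `p` to `q`; then `q` and `w` are equally far from `p`,
  -- at distance `ρ`, so this is no edge. If `M` lies inside `C`, any other component is missed.
  mmodule-misses-component : NonConnectedSpace ρ → ∀ {M} → IsMmodule M → z ∉ M →
    ∃[ C ] (IsMmoduleAt ρ C × M ⊆ ∁ C)
  mmodule-misses-component {ρ} {z} nc {M} mod z∉M with componentOf ρ z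
  ... | C , comp , z∈C with Fin.any? (λ m → (m ∈? C) ×-dec (m ∈? M))
  ...   | no ¬meet = C , comp , λ {m} m∈M → x∉p⇒x∈∁p λ m∈C → ¬meet (m , m∈C , m∈M)
  ...   | yes (m , m∈C , m∈M) with Fin.any? (λ w → (w ∈? M) ×-dec ¬? (w ∈? C))
  ...     | yes (w , w∈M , w∉C)
    with p , q , zp , (_ , p≉q) , p∉M , ¬q∉M ← crossing (λ x → ¬? (x ∈? M)) (connected-in comp z∈C m∈C) z∉M (λ f → f m∈M) =
      ⊥-elim (p≉q (Eq.trans (mod p q w p∉M (decidable-stable (q ∈? M) ¬q∉M) w∈M) (leaving comp (reached comp z∈C zp) w∉C)))
  ...     | no M⊆C with component-proper nc comp
  ...       | w , w∉C with componentOf ρ w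
  ...         | C′ , comp′ , w∈C′ = C′ , comp′ , λ {x} x∈M → x∉p⇒x∈∁p λ x∈C′ →
    M⊆C (x , x∈M , λ x∈C → w∉C (component-⊆ Gᶜ-sym comp′ comp x∈C′ x∈C w∈C′))

  ∁-component-mmodule : ∀ {C} → IsMmoduleAt ρ C → IsMmodule (∁ C)
  ∁-component-mmodule comp z x y z∉ x∈ y∈ =
    Eq.trans (leaving comp (x∉∁p⇒x∈p z∉) (x∈∁p⇒x∉p x∈)) (Eq.sym (leaving comp (x∉∁p⇒x∈p z∉) (x∈∁p⇒x∉p y∈)))

  ∁-component-proper : ∀ {C} → IsMmoduleAt ρ C → ∁ C ≢ ⊤
  ∁-component-proper ((x , x∈C) , _) = ∉⇒≢⊤ (x∈p⇒x∉∁p x∈C)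

  maximal-nonconnected : NonConnectedSpace ρ → ∀ {M} → 𝓜max M → ∃[ C ] (IsMmoduleAt ρ C × M ≡ ∁ C)
  maximal-nonconnected nc (mod , M≢⊤ , max-M) with ≢⊤⇒∃∉ M≢⊤
  ... | z , z∉M with mmodule-misses-component nc mod z∉M
  ...   | C , comp , M⊆∁C = C , comp ,
    sym (max-M (∁ C) (∁-component-mmodule comp) (∁-component-proper comp) M⊆∁C)

  ∁-component-maximal : NonConnectedSpace ρ → ∀ {C} → IsMmoduleAt ρ C → 𝓜max (∁ C)
  ∁-component-maximal {ρ} nc {C} comp = ∁-component-mmodule comp , ∁-component-proper comp , λ N mod N≢⊤ ∁C⊆N →
    ⊆-antisym (λ {x} x∈N → x∉p⇒x∈∁p (λ x∈C → disjoint mod N≢⊤ ∁C⊆N x∈N x∈C)) ∁C⊆N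
    where
    disjoint : ∀ {N} → IsMmodule N → N ≢ ⊤ → ∁ C ⊆ N → x ∈ N → x ∈ C → ⊥
    disjoint {N = N} mod N≢⊤ ∁C⊆N x∈N x∈C with ≢⊤⇒∃∉ N≢⊤ | component-proper nc comp
    ... | z , z∉N | w , w∉C
      -- The points `z` and `x` are both in `C`; the walk between them enters `N` at `q`. Since `w`
      -- is in `N` and outside `C`, the distance from `p` to `q` is that from `p` to `w`, namely
      -- `ρ`.
      with p , q , _ , (_ , p≉q) , p∉N , ¬q∉N ← crossing (λ x → ¬? (x ∈? N))
             (connected-in comp (x∉∁p⇒x∈p (z∉N ∘ ∁C⊆N)) x∈C) z∉N (λ f → f x∈N) =
      p≉q (Eq.trans (mod p q w p∉N (decidable-stable (q ∈? N) ¬q∉N) (∁C⊆N (x∉p⇒x∈∁p w∉C)))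
                    (leaving comp (x∉∁p⇒x∈p (p∉N ∘ ∁C⊆N)) w∉C))

  -- A constant distance δ across a cut is necessarily ρ.
  cut-disconnects : IsRho ρ → ∀ {A : Pred (Fin size) 0ℓ} → Decidable A → A x → ¬ A y →
    (∀ {u v} → A u → ¬ A v → d u v ≈ δ) → NonConnectedSpace ρ
  cut-disconnects {ρ} {a} {b} {δ} (conn , least) {A} A? Aa ¬Ab cut connᶜ
    -- A walk in `G≤ ρ` crosses the cut, hence `δ` is at most `ρ`. Conversely, all pairs across the
    -- cut are edges of `G≤ δ`, and they already connect everything. The edge of `Gᶜ ρ` across the
    -- cut is then impossible.
    with u , v , _ , (_ , uv≤ρ) , Au , ¬Av ← crossing A? (conn a b) Aa ¬Ab
       | p , q , _ , (_ , p≉q) , Ap , ¬Aq ← crossing A? (connᶜ a b) Aa ¬Ab =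
    p≉q (Eq.trans (cut Ap ¬Aq) (≤-antisym (≤-trans (≤-reflexive (Eq.sym (cut Au ¬Av))) uv≤ρ) (least δ conn-δ)))
    where
    edge : ∀ {u v} → A u → ¬ A v → G≤ δ u v
    edge Au ¬Av = (λ { refl → ¬Av Au }) , ≤-reflexive (cut Au ¬Av)
    edge′ : ∀ {u v} → A u → ¬ A v → G≤ δ v u
    edge′ Au ¬Av = (λ { refl → ¬Av Au }) , ≤-trans sym≤ (≤-reflexive (cut Au ¬Av))
    conn-δ : Connected (G≤ δ)
    conn-δ u v with A? u | A? v
    ... | yes Au | no ¬Av = edge Au ¬Av ◅ ε
    ... | no ¬Au | yes Av = edge′ Av ¬Au ◅ ε
    ... | yes Au | yes Av = edge Au ¬Ab ◅ edge′ Av ¬Ab ◅ ε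
    ... | no ¬Au | no ¬Av = edge′ Aa ¬Au ◅ edge Aa ¬Av ◅ ε

  -- A walk cannot leave a block, as all distances to the outside are `ρ`. A component that split
  -- the block would be a cut of the kind excluded by `GoodP.no-cut`. The hypothesis `sep` covers
  -- points outside the subtree, so that the P-node may lie below the root.
  P-blocks-components : ∀ {k} {ts : Vec (PQTree size) (2 + k)} → Good (P ts) →
    (∀ {x y} → Leaves (P ts) x → Leaves (P ts) y → d x y ≤ ρ) →
    (∀ {i j x y} → i ≢ j → Leaves (lookup ts i) x → Leaves (lookup ts j) y → ρ ≤ d x y) →
    (∀ {x y} → Leaves (P ts) x → ¬ Leaves (P ts) y → d x y ≈ ρ) →
    ∀ i → IsMmoduleAt ρ X⟨ lookup ts i ⟩
  P-blocks-components {ρ} {ts = ts} good bd cut sep i = (x₀ , ∈X⁺ {t = tᵢ} x₀∈) , λ x y x∈ → mk⇔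
    (λ y∈ → together (∈X⁻ {t = tᵢ} x∈) (∈X⁻ {t = tᵢ} y∈))
    (λ s → ∈X⁺ {t = tᵢ} (stays (∈X⁻ {t = tᵢ} x∈) s))
    where
    tᵢ  = lookup ts i
    x₀  = proj₁ (someLeaf tᵢ)
    x₀∈ = proj₂ (someLeaf tᵢ)
    together : Leaves tᵢ x → Leaves tᵢ y → Star (Gᶜ ρ) x y
    together {x} {y} x∈ y∈ with componentOf ρ x
    ... | C , comp , x∈C with y ∈? C
    ...   | yes y∈C = connected-in comp x∈C y∈C
    ...   | no y∉C  = ⊥-elim (GoodP.no-cut good (_∈? C) bd cut i
      (λ _ _ u∈ v∉ → ≤-reflexive (Eq.sym (leaving comp u∈ v∉))) x∈ x∈C y∈ y∉C)
    stays : Leaves tᵢ x → Star (Gᶜ ρ) x y → Leaves tᵢ y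
    stays {x} {y} x∈ s = decidable-stable (leaf? tᵢ y) λ y∉ →
      let u , v , _ , (_ , u≉v) , u∈ , v∉ = crossing (leaf? tᵢ) s x∈ y∉
      in u≉v (leave u∈ v∉)
      where
      leave : ∀ {u v} → Leaves tᵢ u → ¬ Leaves tᵢ v → d u v ≈ ρ
      leave {u} {v} u∈ v∉ with leaf? (P ts) v
      ... | no v∉P = sep (∈-frontiers⁺ ts i u∈) v∉P
      ... | yes v∈P with j , v∈j ← ∈-frontiers⁻ ts v∈P =
        ≤-antisym (bd (∈-frontiers⁺ ts i u∈) v∈P) (cut (λ { refl → v∉ v∈j }) u∈ v∈j)

  -- The root is a P-node.

  module PRoot {k} (β : Vec (PQTree size) (2 + k)) (isPQ : IsPQTreeOfSpace (P β)) (ρ : Value) (isρ : IsRho ρ) where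

    private
      full : ∀ x → Leaves (P β) x
      full = all-leaves (P β) isPQ

      good : Good (P β)
      good = good-root (P β) isPQ

      a₀ = proj₁ (someLeaf (lookup β zero))
      a₀∈ = proj₂ (someLeaf (lookup β zero))
      b₀ = proj₁ (someLeaf (lookup β (suc zero)))
      b₀∈ = proj₂ (someLeaf (lookup β (suc zero)))

      b₀∉ : ¬ Leaves (lookup β zero) b₀
      b₀∉ p with () ← block-unique β (Good.unique good) {zero} {suc zero} p b₀∈

      -- The distance between blocks is the largest one, so at this threshold all points are joined.
      ρ≤δ : ρ ≤ d a₀ b₀
      ρ≤δ = proj₂ isρ (d a₀ b₀) connected
        where
        connected : Connected (G≤ (d a₀ b₀))
        connected x y with x Fin.≟ y
        ... | yes refl = ε
        ... | no x≢y = (x≢y , GoodP.across-max good (full x) (full y) (λ ()) a₀∈ b₀∈) ◅ ε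

      -- A walk in `G≤ ρ` from `a₀` to `b₀` has an edge that leaves the first block.
      δ≤ρ : d a₀ b₀ ≤ ρ
      δ≤ρ with crossing (leaf? (lookup β zero)) (proj₁ isρ a₀ b₀) a₀∈ b₀∉
      ... | u , v , _ , (_ , uv≤ρ) , u∈ , v∉ with ∈-frontiers⁻ β (full v)
      ...   | j , v∈j = ≤-trans (GoodP.across-max good (full a₀) (full b₀) (λ { refl → v∉ v∈j }) u∈ v∈j) uv≤ρ

      bounded : d x y ≤ ρ
      bounded = ≤-trans (GoodP.across-max good (full _) (full _) (λ ()) a₀∈ b₀∈) δ≤ρ

      cut : ∀ {i j x y} → i ≢ j → Leaves (lookup β i) x → Leaves (lookup β j) y → ρ ≤ d x y
      cut i≢j x∈ y∈ = ≤-trans ρ≤δ (GoodP.across-max good (full _) (full _) i≢j x∈ y∈)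

      blocks : ∀ i → IsMmoduleAt ρ X⟨ lookup β i ⟩
      blocks = P-blocks-components good (λ _ _ → bounded) cut (λ _ y∉ → ⊥-elim (y∉ (full _)))

      components : ∀ {M} → IsMmoduleAt ρ M → ∃[ i ] M ≡ X⟨ lookup β i ⟩
      components comp@((x , x∈M) , _) with i , x∈i ← ∈-frontiers⁻ β (full x) =
        i , component-≡ Gᶜ-sym comp (blocks i) x∈M (∈X⁺ {t = lookup β i} x∈i)

      nonConnected : NonConnectedSpace ρ
      nonConnected conn = b₀∉ (∈X⁻ {t = lookup β zero} (reached (blocks zero) (∈X⁺ {t = lookup β zero} a₀∈) (conn a₀ b₀)))

    description : NonConnectedSpace ρ ×
      IsMmoduleAt ρ ≐ (λ M → ∃[ i ] M ≡ X⟨ lookup β i ⟩) ×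
      (∀ i → diam X⟨ lookup β i ⟩ ≤ ρ) ×
      𝓜max ≐ (λ M → ∃[ i ] M ≡ ∁ X⟨ lookup β i ⟩)
    description = nonConnected , (components , λ { (i , refl) → blocks i }) , (λ i → diam-≤ (λ _ _ → bounded)) ,
      ( (λ M∈ → let C , comp , eq = maximal-nonconnected nonConnected M∈
                    i , eq′ = components comp
                in i , trans eq (cong ∁ eq′))
      , λ { (i , refl) → ∁-component-maximal nonConnected (blocks i) } )

  -- Enlarging mmodules: maximal ones, unions and convex hulls.

  mmodule? : Decidable IsMmodule
  mmodule? M = Fin.all? λ z → Fin.all? λ x → Fin.all? λ y →
    ¬? (z ∈? M) →-dec x ∈? M →-dec y ∈? M →-dec d z x ≈? d z y

  maximal-above : ∀ {N} → IsMmodule N → N ≢ ⊤ → ∃[ M ] (𝓜max M × N ⊆ M)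
  maximal-above {N} = go N (⊃-wellFounded N)
    where
    go : ∀ N → Acc _⊃_ N → IsMmodule N → N ≢ ⊤ → ∃[ M ] (𝓜max M × N ⊆ M)
    go N (acc rec) mod N≢⊤
      with anySubset? (λ M → mmodule? M ×-dec ¬? (M ≟ˢ ⊤) ×-dec (N ⊆? M) ×-dec ¬? (M ≟ˢ N))
    ... | no ¬larger = N , (mod , N≢⊤ , λ M mod′ M≢⊤ N⊆M →
            decidable-stable (M ≟ˢ N) λ M≢N → ¬larger (M , mod′ , M≢⊤ , N⊆M , M≢N)) , id
    ... | yes (N′ , mod′ , N′≢⊤ , N⊆N′ , N′≢N) with Fin.any? (λ x → (x ∈? N′) ×-dec ¬? (x ∈? N))
    ...   | yes (x , x∈ , x∉) with M , max-M , N′⊆M ← go N′ (rec (N⊆N′ , x , x∈ , x∉)) mod′ N′≢⊤ =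
      M , max-M , N′⊆M ∘ N⊆N′
    ...   | no ¬strict = ⊥-elim (N′≢N (⊆-antisym
      (λ {x} x∈ → decidable-stable (x ∈? N) λ x∉ → ¬strict (x , x∈ , x∉)) N⊆N′))

  -- From a point outside, both sets are as far away as their common point.
  ∪-mmodule : ∀ {M N} → IsMmodule M → IsMmodule N → x ∈ M → x ∈ N → IsMmodule (M ∪ N)
  ∪-mmodule {p} {M} {N} modM modN p∈M p∈N z x y z∉ x∈ y∈ = Eq.trans (toP x∈) (Eq.sym (toP y∈))
    where
    toP : ∀ {x} → x ∈ M ∪ N → d z x ≈ d z p
    toP {x} x∈ with x∈p∪q⁻ M N x∈
    ... | inj₁ q = modM z x p (z∉ ∘ x∈p∪q⁺ ∘ inj₁) q p∈M
    ... | inj₂ q = modN z x p (z∉ ∘ x∈p∪q⁺ ∘ inj₂) q p∈N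

  module _ {_≺_ : Rel (Fin size) 0ℓ} (order : IsOrder _≺_)
           (triple : ∀ {x y z} → x ≺ y → y ≺ z → d x y ≤ d x z × d y z ≤ d x z) where

    open Order order using (compare; asym; ≺-trans; _≺?_)

    private
      infix 4 _≼_
      _≼_ : Rel (Fin size) 0ℓ
      x ≼ y = x ≡ y ⊎ x ≺ y

      _≼?_ : Decidable₂ _≼_
      x ≼? y with compare x y
      ... | tri< p _ _    = yes (inj₂ p)
      ... | tri≈ _ p _    = yes (inj₁ p)
      ... | tri> ¬p ¬q _  = no Sum.[ ¬q , ¬p ]

      ⋠⇒≻ : ¬ x ≼ y → y ≺ x
      ⋠⇒≻ {x} {y} ¬p with compare x y
      ... | tri< p _ _ = ⊥-elim (¬p (inj₂ p))
      ... | tri≈ _ p _ = ⊥-elim (¬p (inj₁ p))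
      ... | tri> _ _ p = p

      upward : x ≼ y → z ≺ x → d z x ≤ d z y
      upward (inj₁ refl) _ = ≤-refl
      upward (inj₂ p)    q = proj₁ (triple q p)

      downward : x ≼ y → y ≺ z → d z y ≤ d z x
      downward (inj₁ refl) _ = ≤-refl
      downward (inj₂ p)    q = swap≤ (proj₂ (triple p q))

      ≼-≺ : x ≼ y → y ≺ z → x ≺ z
      ≼-≺ (inj₁ refl) q = q
      ≼-≺ (inj₂ p)    q = ≺-trans p q

      ≺-≼ : x ≺ y → y ≼ z → x ≺ z
      ≺-≼ p (inj₁ refl) = p
      ≺-≼ p (inj₂ q)    = ≺-trans p q

      ≼∧≢⇒≺ : x ≼ y → x ≢ y → x ≺ y
      ≼∧≢⇒≺ (inj₁ e) x≢y = ⊥-elim (x≢y e)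
      ≼∧≢⇒≺ (inj₂ p) _   = p

    module Hull {M : Subset size} (mod : IsMmodule M) where

      Hull : Pred (Fin size) 0ℓ
      Hull h = (∃[ a ] (a ∈ M × a ≼ h)) × (∃[ b ] (b ∈ M × h ≼ b))

      hull? : Decidable Hull
      hull? h = Fin.any? (λ a → (a ∈? M) ×-dec (a ≼? h)) ×-dec Fin.any? (λ b → (b ∈? M) ×-dec (h ≼? b))

      M⊆hull : x ∈ M → Hull x
      M⊆hull x∈ = (_ , x∈ , inj₁ refl) , (_ , x∈ , inj₁ refl)

      -- All of `M` is on one side of `w`, and distances from `w` grow along the order on that side.
      -- So `x` is at most as far as some point of `M`, and `y` at least as far as some point of
      -- `M`; from `w` these two are equally far.
      hull-≤ : ∀ {w x y} → ¬ Hull w → Hull x → Hull y → d w x ≤ d w y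
      hull-≤ {w} ¬hw ((a , a∈ , a≼x) , (b , b∈ , x≼b)) ((a′ , a′∈ , a′≼y) , (b′ , b′∈ , y≼b′))
        with Fin.any? (λ m → (m ∈? M) ×-dec (m ≼? w))
      ... | yes below = ≤-trans (downward a≼x (≼-≺ x≼b (≺w b∈)))
                          (≤-trans (≤-reflexive (mod w a b′ (¬hw ∘ M⊆hull) a∈ b′∈)) (downward y≼b′ (≺w b′∈)))
        where
        ≺w : ∀ {m} → m ∈ M → m ≺ w
        ≺w m∈ = ⋠⇒≻ λ w≼m → ¬hw (below , (_ , m∈ , w≼m))
      ... | no ¬below = ≤-trans (upward x≼b (≺-≼ (w≺ a∈) a≼x))
                          (≤-trans (≤-reflexive (mod w b a′ (¬hw ∘ M⊆hull) b∈ a′∈)) (upward a′≼y (w≺ a′∈)))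
        where
        w≺ : ∀ {m} → m ∈ M → w ≺ m
        w≺ m∈ = ⋠⇒≻ λ m≼w → ¬below (_ , m∈ , m≼w)

      -- Points of `M` may be exchanged freely. To pass from `z` to `z′`, a point of `M` is chosen
      -- beyond `z` on the side away from `z′`; it exists because the hull is everything.
      constant-≤ : (∀ h → Hull h) → ∀ {m m′ z z′} → m ∈ M → m′ ∈ M → z ∉ M → z′ ∉ M → d m z ≤ d m′ z′
      constant-≤ all {m} {m′} {z} {z′} m∈ m′∈ z∉ z′∉ with compare z z′
      ... | tri≈ _ refl _ = swap≤ (≤-reflexive (mod z m m′ z∉ m∈ m′∈))
      ... | tri< z≺z′ _ _ with (a , a∈ , a≼z) , _ ← all z =
        ≤-trans (swap≤ (≤-reflexive (mod z m a z∉ m∈ a∈)))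
          (≤-trans (proj₁ (triple (≼∧≢⇒≺ a≼z λ { refl → z∉ a∈ }) z≺z′)) (swap≤ (≤-reflexive (mod z′ a m′ z′∉ a∈ m′∈))))
      ... | tri> _ _ z′≺z with _ , (b , b∈ , z≼b) ← all z =
        ≤-trans (swap≤ (≤-reflexive (mod z m b z∉ m∈ b∈)))
          (≤-trans (swap≤ (proj₂ (triple z′≺z (≼∧≢⇒≺ z≼b λ { refl → z∉ b∈ })))) (swap≤ (≤-reflexive (mod z′ b m′ z′∉ b∈ m′∈))))

    maximal-contiguous : IsRho ρ → ConnectedSpace ρ → ∀ {M} → 𝓜max M → Contiguous _≺_ (_∈ M)
    maximal-contiguous isρ conn {M} (mod , M≢⊤ , max-M) {x} {y} {z} x∈ z∈ x≺y y≺z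
      with H , H⇔ ← subset (Hull.hull? mod) with H ≟ˢ ⊤
    ... | no H≢⊤ = subst (y ∈_) (max-M H modH H≢⊤ (from H⇔ ∘ M⊆hull)) (from H⇔ ((x , x∈ , inj₂ x≺y) , (z , z∈ , inj₂ y≺z)))
      where
      open Hull mod
      open Equivalence
      modH : IsMmodule H
      modH w u v w∉ u∈ v∈ = ≤-antisym (hull-≤ (w∉ ∘ from H⇔) (to H⇔ u∈) (to H⇔ v∈))
                                      (hull-≤ (w∉ ∘ from H⇔) (to H⇔ v∈) (to H⇔ u∈))
    ... | yes refl = decidable-stable (y ∈? M) λ y∉ → cut-disconnects isρ {A = _∈ M} (_∈? M) x∈ y∉
      (λ u∈ v∉ → ≤-antisym (constant-≤ all u∈ x∈ v∉ y∉) (constant-≤ all x∈ u∈ y∉ v∉)) conn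
      where
      open Hull mod
      all : ∀ h → Hull h
      all h = Equivalence.to H⇔ ∈⊤

  -- The component `C` cuts the leaves of `t` at the maximal distance `ρ`. A single leaf cannot be
  -- cut and a Q-node admits no such cut, which leaves a P-node.
  P-of-components : ∀ {t C} → Good t →
    (∀ {x y} → Leaves t x → Leaves t y → d x y ≤ ρ) →
    (∀ {x y} → Leaves t x → ¬ Leaves t y → d x y ≈ ρ) →
    IsMmoduleAt ρ C → Leaves t x → x ∈ C → Leaves t y → y ∉ C →
    ∃[ m ] ∃[ γ ] (t ≡ P {k = m} γ × (∀ j → IsMmoduleAt ρ X⟨ lookup γ j ⟩))
  P-of-components {t = leaf _} good bd sep comp (here refl) x∈C (here refl) y∉C = ⊥-elim (y∉C x∈C)
  P-of-components {t = Q ts} {C} good bd sep comp x∈ x∈C y∈ y∉C =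
    ⊥-elim (GoodQ.no-cut good (_∈? C) bd (λ _ _ u∈ v∉ → ≤-reflexive (Eq.sym (leaving comp u∈ v∉))) x∈ x∈C y∈ y∉C)
  P-of-components {t = P γ} good bd sep comp x∈ x∈C y∈ y∉C = _ , γ , refl , P-blocks-components good bd
    (λ i≢j u∈ v∈ → ≤-trans (≤-reflexive (Eq.sym (leaving comp x∈C y∉C))) (GoodP.across-max good x∈ y∈ i≢j u∈ v∈)) sep

  -- The root is a Q-node.

  module QRoot {k} (β : Vec (PQTree size) (3 + k)) (isPQ : IsPQTreeOfSpace (Q β)) (ρ : Value) (isρ : IsRho ρ) where

    private
      full : ∀ x → Leaves (Q β) x
      full = all-leaves (Q β) isPQ

      good : Good (Q β)
      good = good-root (Q β) isPQ

    open Good good using (_≺_; order; base; compatible; unique)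
    open Order order using (compare; asym; ≺-trans; _≺?_)
    open GoodQ good using (block-module; module-in-block; no-cut; good-child)

    private
      Block : Fin (3 + k) → Pred (Fin size) 0ℓ
      Block i = Leaves (lookup β i)

      ∈B⁺ : ∀ {i x} → Block i x → x ∈ X⟨ lookup β i ⟩
      ∈B⁺ {i} = ∈X⁺ {t = lookup β i}

      ∈B⁻ : ∀ {i x} → x ∈ X⟨ lookup β i ⟩ → Block i x
      ∈B⁻ {i} = ∈X⁻ {t = lookup β i}

      triple : x ≺ y → y ≺ z → d x y ≤ d x z × d y z ≤ d x z
      triple = compatible (full _) (full _) (full _)

      another : (i : Fin (3 + k)) → ∃[ j ] j ≢ i
      another zero    = suc zero , λ ()
      another (suc i) = zero , λ ()

      outside-block : ∀ i → ∃[ w ] ¬ Block i w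
      outside-block i with another i
      ... | j , j≢i with someLeaf (lookup β j)
      ...   | w , w∈j = w , λ w∈i → j≢i (block-unique β unique w∈j w∈i)

      block-mmodule : ∀ i → IsMmodule X⟨ lookup β i ⟩
      block-mmodule i z x y z∉ x∈ y∈ = ≤-antisym
        (block-module full i (z∉ ∘ ∈B⁺) (∈B⁻ x∈) (∈B⁻ y∈)) (block-module full i (z∉ ∘ ∈B⁺) (∈B⁻ y∈) (∈B⁻ x∈))

      block-proper : ∀ i → X⟨ lookup β i ⟩ ≢ ⊤
      block-proper i = ∉⇒≢⊤ (proj₂ (outside-block i) ∘ ∈B⁻)

    connected-case : ConnectedSpace ρ → 𝓜max ≐ (λ M → ∃[ i ] M ≡ X⟨ lookup β i ⟩)
    connected-case conn = is-block , λ { (i , refl) → block-maximal i }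
      where
      -- The union of `M` and the block is an mmodule, so maximality decides unless it is
      -- everything. In that case, if `M` has a point `p` outside the block, the distance across the
      -- cut between `M` and its complement is constantly `d p y`, against connectedness.
      absorbs : ∀ {M i x} → 𝓜max M → x ∈ M → Block i x → X⟨ lookup β i ⟩ ⊆ M
      absorbs {M} {i} {x} (mod , M≢⊤ , max-M) x∈M x∈i {y} y∈B = decidable-stable (y ∈? M) absurd
        where
        B = X⟨ lookup β i ⟩
        union : IsMmodule (M ∪ B)
        union = ∪-mmodule mod (block-mmodule i) x∈M (∈B⁺ x∈i)
        absurd : ¬ (y ∉ M)
        absurd y∉M with (M ∪ B) ≟ˢ ⊤ | Fin.any? (λ u → (u ∈? M) ×-dec ¬? (u ∈? B))
        ... | no proper | _ = y∉M (subst (y ∈_) (max-M (M ∪ B) union proper (p⊆p∪q B)) (x∈p∪q⁺ (inj₂ y∈B)))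
        ... | yes _ | no M⊆B = y∉M (subst (y ∈_) (max-M B (block-mmodule i) (block-proper i)
                λ {u} u∈ → decidable-stable (u ∈? B) λ u∉ → M⊆B (u , u∈ , u∉)) y∈B)
        ... | yes M∪B≡⊤ | yes (p , p∈M , p∉B) =
          cut-disconnects isρ {A = _∈ M} (_∈? M) x∈M y∉M (λ {u} {v} → constant {u} {v}) conn
          where
          constant : ∀ {u v} → u ∈ M → v ∉ M → d u v ≈ d p y
          constant {u} {v} u∈ v∉ = Eq.trans (d-sym u v) (Eq.trans (mod v u p v∉ u∈ p∈M)
            (Eq.trans (d-sym v p) (block-mmodule i p v y p∉B v∈B y∈B)))
            where
            v∈B : v ∈ B
            v∈B = Sum.[ ⊥-elim ∘ v∉ , id ] (x∈p∪q⁻ M B (subst (v ∈_) (sym M∪B≡⊤) ∈⊤))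

      is-block : ∀ {M} → 𝓜max M → ∃[ i ] M ≡ X⟨ lookup β i ⟩
      is-block {M} M-max@(mod , M≢⊤ , max-M) with Fin.any? (_∈? M)
      -- The empty set lies in the first block, with which maximality would identify it.
      ... | no empty = zero , sym (max-M _ (block-mmodule zero) (block-proper zero) λ x∈ → ⊥-elim (empty (_ , x∈)))
      ... | yes (x , x∈M) with i , x∈i ← ∈-frontiers⁻ β (full x) = i , ⊆-antisym M⊆B (absorbs M-max x∈M x∈i)
        where
        M⊆B : M ⊆ X⟨ lookup β i ⟩
        M⊆B {y} y∈M with j , y∈j ← ∈-frontiers⁻ β (full y) | w , w∉M ← ≢⊤⇒∃∉ M≢⊤
          with refl ← module-in-block (_∈? M) full (maximal-contiguous order triple isρ conn M-max)
                        (λ z∉ p q → ≤-reflexive (mod _ _ _ z∉ p q)) x∈i y∈j x∈M y∈M w∉M = ∈B⁺ y∈j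

      -- A maximal mmodule above a block is itself a block, and different blocks are disjoint.
      block-maximal : ∀ i → 𝓜max X⟨ lookup β i ⟩
      block-maximal i with maximal-above (block-mmodule i) (block-proper i)
      ... | M , M-max , B⊆M with is-block M-max | someLeaf (lookup β i)
      ...   | j , refl | x , x∈i with refl ← block-unique β unique x∈i (∈B⁻ {j} (B⊆M (∈B⁺ x∈i))) = M-max

    module _ (nc : NonConnectedSpace ρ) where

      private
        -- If no distance exceeded `ρ`, a component would be a cut at the maximal distance, which a
        -- Q-node does not admit.
        far-pair : ∃[ a ] ∃[ b ] ¬ d a b ≤ ρ
        far-pair with Fin.any? (λ a → Fin.any? (λ b → ¬? (d a b ≤? ρ)))
        ... | yes p = p
        ... | no all-near with Fin.any? (λ x → Fin.any? (λ y → ¬? (y ∈? proj₁ (componentOf ρ x))))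
        ...   | no ¬apart = ⊥-elim (nc λ x y → let C , comp , x∈C = componentOf ρ x in
                  connected-in comp x∈C (decidable-stable (y ∈? C) λ y∉ → ¬apart (x , y , y∉)))
        ...   | yes (x , y , y∉C) = let C , comp , x∈C = componentOf ρ x in
          ⊥-elim (no-cut (_∈? C) (λ {u} {v} _ _ → decidable-stable (d u v ≤? ρ) λ ¬p → all-near (u , v , ¬p))
            (λ _ _ u∈ v∉ → ≤-reflexive (Eq.sym (leaving comp u∈ v∉))) (full x) x∈C (full y) y∉C)

        ordered-far-pair : ∃[ a ] ∃[ b ] (a ≺ b × ¬ d a b ≤ ρ)
        ordered-far-pair with a , b , far ← far-pair with compare a b
        ... | tri< a≺b _ _  = a , b , a≺b , far
        ... | tri≈ _ refl _ = ⊥-elim (far (≤-trans (≤-reflexive (d-refl a)) (0-min _)))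
        ... | tri> _ _ b≺a  = b , a , b≺a , λ p → far (≤-trans sym≤ p)

      -- The large component and the apex child.

      module Large {a b} (a≺b : a ≺ b) (far : ¬ d a b ≤ ρ) {S₀} (comp₀ : IsMmoduleAt ρ S₀) (a∈S₀ : a ∈ S₀)
                   {z₀} (z₀∉ : z₀ ∉ S₀) {i} (z₀∈i : Block i z₀) where

        b∈S₀ : b ∈ S₀
        b∈S₀ = decidable-stable (b ∈? S₀) λ b∉ → far (≤-reflexive (leaving comp₀ a∈S₀ b∉))

        leaving₀ : x ∈ S₀ → y ∉ S₀ → d x y ≈ ρ
        leaving₀ = leaving comp₀

        -- A point outside `S₀` is at distance `ρ` from `b`. If it came before `a`, then `d a b`
        -- would be at most `ρ`.
        after-a : z ∉ S₀ → a ≺ z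
        after-a {z} z∉ with compare a z
        ... | tri< p _ _    = p
        ... | tri≈ _ refl _ = ⊥-elim (z∉ a∈S₀)
        ... | tri> _ _ z≺a  = ⊥-elim (far (≤-trans (proj₂ (triple z≺a a≺b)) (≤-trans sym≤ (≤-reflexive (leaving₀ b∈S₀ z∉)))))

        before-b : z ∉ S₀ → z ≺ b
        before-b {z} z∉ with compare z b
        ... | tri< p _ _    = p
        ... | tri≈ _ refl _ = ⊥-elim (z∉ b∈S₀)
        ... | tri> _ _ b≺z  = ⊥-elim (far (≤-trans (proj₁ (triple a≺b b≺z)) (≤-reflexive (leaving₀ a∈S₀ z∉))))

        -- Points of S₀ between two points of the complement are at distance ρ from
        -- those which are not, although S₀ is connected by pairs at other distances.
        contiguous₀ : Contiguous _≺_ (_∉ S₀)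
        contiguous₀ {x} {y} {z} x∉ z∉ x≺y y≺z y∈
          -- The point `a` of `S₀` precedes `x`, so a walk from `y` to `a` leaves the interval from
          -- `x` to `z`, going from `u` to `v`.
          with u , v , yu , uv@(_ , u≉v) , (x≺u , u≺z) , ¬between ←
            crossing (λ t → (x ≺? t) ×-dec (t ≺? z)) (connected-in comp₀ y∈ a∈S₀) (x≺y , y≺z)
              (λ (x≺a , _) → asym x≺a (after-a x∉)) =
          u≉v (separated (reached comp₀ y∈ yu) (reached comp₀ y∈ (yu ◅◅ uv ◅ ε)) x≺u u≺z ¬between)
          where
          separated : ∀ {u v} → u ∈ S₀ → v ∈ S₀ → x ≺ u → u ≺ z → ¬ (x ≺ v × v ≺ z) → d u v ≈ ρ
          -- If `v` precedes `x`, then `d v u` is squeezed between `d v x` and `d v z`, both equal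
          -- to `ρ`. If `v` follows `z`, then `d u v` is squeezed between `d u z` and `d x v`.
          separated {u} {v} u∈ v∈ x≺u u≺z ¬between with compare x v
          ... | tri≈ _ refl _ = ⊥-elim (x∉ v∈)
          ... | tri> _ _ v≺x  = ≤-antisym
            (≤-trans sym≤ (≤-trans (proj₁ (triple (≺-trans v≺x x≺u) u≺z)) (≤-reflexive (leaving₀ v∈ z∉))))
            (≤-trans (≤-reflexive (Eq.sym (leaving₀ v∈ x∉))) (≤-trans (proj₁ (triple v≺x x≺u)) sym≤))
          ... | tri< x≺v _ _ with compare z v
          ...   | tri≈ _ refl _ = ⊥-elim (z∉ v∈)
          ...   | tri> _ _ v≺z  = ⊥-elim (¬between (x≺v , v≺z))
          ...   | tri< z≺v _ _  = ≤-antisym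
            (≤-trans (proj₂ (triple x≺u (≺-trans u≺z z≺v))) (≤-trans sym≤ (≤-reflexive (leaving₀ v∈ x∉))))
            (≤-trans (≤-reflexive (Eq.sym (leaving₀ u∈ z∉))) (proj₁ (triple u≺z z≺v)))

        ∈S₀-stable : ¬ x ∉ S₀ → x ∈ S₀
        ∈S₀-stable {x} = decidable-stable (x ∈? S₀)

        -- The complement of `S₀` is a contiguous mmodule that omits `a`, so it lies in one block,
        -- the one of `z₀`.
        ∉S₀⇒∈block : z ∉ S₀ → Block i z
        ∉S₀⇒∈block {z} z∉ with j , z∈j ← ∈-frontiers⁻ β (full z)
          with refl ← module-in-block (λ x → ¬? (x ∈? S₀)) full contiguous₀
                 (λ u∈ x∉ y∉ → ≤-reflexive (Eq.trans (leaving₀ (∈S₀-stable u∈) x∉) (Eq.sym (leaving₀ (∈S₀-stable u∈) y∉))))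
                 z₀∈i z∈j z₀∉ z∉ (λ a∉ → a∉ a∈S₀) = z∈j

        -- Otherwise a walk in `S₀` would leave the block by an edge from `u` to `v`. But `v` is as
        -- far from `u` as from `z₀`, that is, at distance `ρ`.
        ∈block⇒∉S₀ : Block i z → z ∉ S₀
        ∈block⇒∉S₀ {z} z∈i z∈S₀ with w , w∉i ← outside-block i
          with u , v , _ , (_ , u≉v) , u∈ , v∉ ← crossing (leaf? (lookup β i))
                 (connected-in comp₀ z∈S₀ (∈S₀-stable (w∉i ∘ ∉S₀⇒∈block))) z∈i w∉i =
          u≉v (Eq.trans (d-sym u v) (Eq.trans (block-mmodule i v u z₀ (v∉ ∘ ∈B⁻) (∈B⁺ u∈) (∈B⁺ z₀∈i))
                (leaving₀ (∈S₀-stable (v∉ ∘ ∉S₀⇒∈block)) z₀∉)))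

        Z : Subset size
        Z = X⟨ lookup β i ⟩

        S₀≡∁Z : S₀ ≡ ∁ Z
        S₀≡∁Z = ⊆-antisym (λ x∈ → x∉p⇒x∈∁p λ x∈Z → ∈block⇒∉S₀ (∈B⁻ x∈Z) x∈)
                          (λ x∈ → ∈S₀-stable (x∈∁p⇒x∉p x∈ ∘ ∈B⁺ ∘ ∉S₀⇒∈block))

        ∁S₀≡Z : ∁ S₀ ≡ Z
        ∁S₀≡Z = trans (cong ∁ S₀≡∁Z) (∁-involutive Z)

        large : IsLargeMmoduleAt ρ S₀
        large = comp₀ , ≰⇒> λ p → far (≤-trans (≤-diam a∈S₀ b∈S₀) p)

        -- The point `a` precedes `z₀` and is in another block; for the last child, `b` takes this
        -- place.
        i≢zero : i ≢ zero
        i≢zero i≡0 with j , a∈j ← ∈-frontiers⁻ β (full a) =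
          asym (after-a z₀∉) (base (before-blocks β i<j z₀∈i a∈j))
          where
          i<j : i Fin.< j
          i<j = Fin.≤∧≢⇒< (subst (Fin._≤ j) (sym i≡0) ℕ.z≤n) λ { refl → ∈block⇒∉S₀ a∈j a∈S₀ }

        i≢last : i ≢ fromℕ (2 + k)
        i≢last i≡last with j , b∈j ← ∈-frontiers⁻ β (full b) =
          asym (before-b z₀∉) (base (before-blocks β j<i b∈j z₀∈i))
          where
          j<i : j Fin.< i
          j<i = Fin.≤∧≢⇒< (subst (j Fin.≤_) (sym i≡last) (Fin.≤fromℕ j)) λ { refl → ∈block⇒∉S₀ b∈j b∈S₀ }

        apex : IsApex ρ β i
        apex j j≢i x y x∈ y∈ = Eq.trans (d-sym x y) (leaving₀
          (∈S₀-stable λ y∉ → j≢i (block-unique β unique (∈B⁻ y∈) (∉S₀⇒∈block y∉)))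
          (∈block⇒∉S₀ (∈B⁻ x∈)))

        -- Both points precede `b`, so the earlier one is at least as far from `b`, at distance `ρ`,
        -- as from the later one.
        near : x ∉ S₀ → y ∉ S₀ → d x y ≤ ρ
        near {x} {y} x∉ y∉ with compare x y
        ... | tri< x≺y _ _  = ≤-trans (proj₁ (triple x≺y (before-b y∉))) (≤-trans sym≤ (≤-reflexive (leaving₀ b∈S₀ x∉)))
        ... | tri≈ _ refl _ = ≤-trans (≤-reflexive (d-refl x)) (0-min _)
        ... | tri> _ _ y≺x  = ≤-trans sym≤ (≤-trans (proj₁ (triple y≺x (before-b x∉)))
                                (≤-trans sym≤ (≤-reflexive (leaving₀ b∈S₀ y∉))))

        S₀-or-disjoint : ∀ {C} → IsMmoduleAt ρ C → C ≢ S₀ → x ∈ C → x ∉ S₀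
        S₀-or-disjoint comp C≢S₀ x∈C x∈S₀ = C≢S₀ (component-≡ Gᶜ-sym comp comp₀ x∈C x∈S₀)

        Z-maximal : 𝓜max Z
        Z-maximal = subst 𝓜max ∁S₀≡Z (∁-component-maximal nc comp₀)

        -- The block `Z` is the union of the components other than `S₀`. Only one is left, so `Z`
        -- itself is a component.
        two-components : HasCardinality (IsMmoduleAt ρ) 2 → 𝓜max ≐ (λ M → M ≡ Z ⊎ M ≡ ∁ Z)
        two-components (L , _ , (to-L , _) , |L|≡2) =
          classify , λ { (inj₁ refl) → Z-maximal ; (inj₂ refl) → ∁-component-maximal nc Z-component }
          where
          pigeonhole : ∀ {A : Set} {L : List A} {s x y} → List.length L ≡ 2 → s ∈ₗ L → x ∈ₗ L → y ∈ₗ L →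
            x ≢ s → y ≢ s → x ≡ y
          pigeonhole {L = p ∷ q ∷ []} refl (here refl) (here refl) _ x≢s _ = ⊥-elim (x≢s refl)
          pigeonhole {L = p ∷ q ∷ []} refl (here refl) _ (here refl) _ y≢s = ⊥-elim (y≢s refl)
          pigeonhole {L = p ∷ q ∷ []} refl (there (here refl)) (there (here refl)) _ x≢s _ = ⊥-elim (x≢s refl)
          pigeonhole {L = p ∷ q ∷ []} refl (there (here refl)) _ (there (here refl)) _ y≢s = ⊥-elim (y≢s refl)
          pigeonhole {L = p ∷ q ∷ []} refl _ (here refl) (here refl) _ _ = refl
          pigeonhole {L = p ∷ q ∷ []} refl _ (there (here refl)) (there (here refl)) _ _ = refl

          ≡Z : ∀ {C} → IsMmoduleAt ρ C → C ≢ S₀ → C ≡ Z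
          ≡Z {C} comp C≢S₀ = ⊆-antisym (∈B⁺ ∘ ∉S₀⇒∈block ∘ S₀-or-disjoint comp C≢S₀) λ {x} x∈Z →
            let C′ , comp′ , x∈C′ = componentOf ρ x
            in subst (x ∈_) (pigeonhole |L|≡2 (to-L comp₀) (to-L comp′) (to-L comp)
                 (λ e → ∈block⇒∉S₀ (∈B⁻ x∈Z) (subst (x ∈_) e x∈C′)) C≢S₀) x∈C′

          Z-component : IsMmoduleAt ρ Z
          Z-component with C , comp , z₀∈C ← componentOf ρ z₀ =
            subst (IsMmoduleAt ρ) (≡Z comp λ { refl → z₀∉ z₀∈C }) comp

          classify : ∀ {M} → 𝓜max M → M ≡ Z ⊎ M ≡ ∁ Z
          classify M-max with maximal-nonconnected nc M-max
          ... | C , comp , refl with C ≟ˢ S₀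
          ...   | yes refl = inj₁ ∁S₀≡Z
          ...   | no C≢S₀  = inj₂ (cong ∁ (≡Z comp C≢S₀))

        two-others : ∀ {L : List (Subset size)} → Unique L → List.length L ≥ 3 →
          ∃[ C ] ∃[ C′ ] (C ∈ₗ L × C′ ∈ₗ L × C ≢ C′ × C ≢ S₀ × C′ ≢ S₀)
        two-others {p ∷ q ∷ r ∷ _} ((p≢q ∷ p≢r ∷ _) ∷ (q≢r ∷ _) ∷ _) _ with p ≟ˢ S₀ | q ≟ˢ S₀
        ... | yes refl | _        = q , r , there (here refl) , there (there (here refl)) , q≢r , p≢q ∘ sym , p≢r ∘ sym
        ... | no p≢S₀  | yes refl = p , r , here refl , there (there (here refl)) , p≢r , p≢S₀ , q≢r ∘ sym
        ... | no p≢S₀  | no q≢S₀  = p , q , here refl , there (here refl) , p≢q , p≢S₀ , q≢S₀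
        two-others {_ ∷ []}     _ (ℕ.s≤s ())
        two-others {_ ∷ _ ∷ []} _ (ℕ.s≤s (ℕ.s≤s ()))

        module Split {m} {γ : Vec (PQTree size) (2 + m)} (eq : lookup β i ≡ P γ)
                     (comps : ∀ j → IsMmoduleAt ρ X⟨ lookup γ j ⟩) where

          γ-∉S₀ : ∀ {j} → Leaves (lookup γ j) y → y ∉ S₀
          γ-∉S₀ {y} {j} y∈ = ∈block⇒∉S₀ (subst (λ t → Leaves t y) (sym eq) (∈-frontiers⁺ γ j y∈))

          is-child : ∀ {D} → IsMmoduleAt ρ D → D ≢ S₀ → ∃[ j ] D ≡ X⟨ lookup γ j ⟩
          is-child D-comp@((y , y∈D) , _) D≢S₀
            with j , y∈j ← ∈-frontiers⁻ γ (subst (λ t → Leaves t y) eq (∉S₀⇒∈block (S₀-or-disjoint D-comp D≢S₀ y∈D))) =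
            j , component-≡ Gᶜ-sym D-comp (comps j) y∈D (∈X⁺ {t = lookup γ j} y∈j)

          -- Two lists without repetitions and with the same elements, `L` and `S₀` followed by the
          -- children of `γ`, have the same length.
          count : ∀ {cρ} → HasCardinality (IsMmoduleAt ρ) cρ → 2 + m ≡ cρ ∸ 1
          count (L , L! , (to-L , from-L) , refl) = trans (sym (List.length-tabulate children))
            (cong (_∸ 1) (↭-length (∼bag⇒↭ (unique∧set⇒bag unique-all L! (mk⇔ to from)))))
            where
            children : Fin (2 + m) → Subset size
            children j = X⟨ lookup γ j ⟩
            all : List (Subset size)
            all = S₀ ∷ List.tabulate children
            injective : ∀ {j j′} → children j ≡ children j′ → j ≡ j′
            injective {j} {j′} e with y , y∈ ← someLeaf (lookup γ j) = block-unique γ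
              (Good.unique (subst Good eq (good-child full i))) y∈
              (∈X⁻ {t = lookup γ j′} (subst (y ∈_) e (∈X⁺ {t = lookup γ j} y∈)))
            S₀≢child : ∀ j → S₀ ≢ children j
            S₀≢child j e with y , y∈ ← someLeaf (lookup γ j) =
              γ-∉S₀ {j = j} y∈ (subst (y ∈_) (sym e) (∈X⁺ {t = lookup γ j} y∈))
            unique-all : Unique all
            unique-all = tabulate⁺ S₀≢child ∷ Unique.tabulate⁺ injective
            to : ∀ {D} → D ∈ₗ all → D ∈ₗ L
            to (here refl) = to-L comp₀
            to (there p) with j , refl ← ∈-tabulate⁻ {f = children} p = to-L (comps j)
            from : ∀ {D} → D ∈ₗ L → D ∈ₗ all
            from {D} p with D ≟ˢ S₀
            ... | yes refl = here refl
            ... | no D≢S₀ with j , refl ← is-child (from-L p) D≢S₀ = there (∈-tabulate⁺ {f = children} j)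

          maximal : 𝓜max ≐ (λ M → (∃[ j ] M ≡ ∁ X⟨ lookup γ j ⟩) ⊎ M ≡ Z)
          maximal = classify , λ { (inj₁ (j , refl)) → ∁-component-maximal nc (comps j) ; (inj₂ refl) → Z-maximal }
            where
            classify : ∀ {M} → 𝓜max M → (∃[ j ] M ≡ ∁ X⟨ lookup γ j ⟩) ⊎ M ≡ Z
            classify M-max with maximal-nonconnected nc M-max
            ... | D , D-comp , refl with D ≟ˢ S₀
            ...   | yes refl = inj₂ ∁S₀≡Z
            ...   | no D≢S₀ with j , refl ← is-child D-comp D≢S₀ = inj₁ (j , refl)

        -- Two components different from `S₀` both lie in the block, and one does not contain the
        -- points of the other.
        Z-disconnected : ∀ {cρ} → HasCardinality (IsMmoduleAt ρ) cρ → cρ ≥ 3 →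
          ∃[ C ] ∃[ x ] ∃[ y ] (IsMmoduleAt ρ C × Block i x × x ∈ C × Block i y × y ∉ C)
        Z-disconnected (L , L! , (_ , from-L) , refl) L≥3
          with C , C′ , C∈L , C′∈L , C≢C′ , C≢S₀ , C′≢S₀ ← two-others L! L≥3
          with comp@((x , x∈C) , _) ← from-L C∈L | comp′@((y , y∈C′) , _) ← from-L C′∈L =
          C , x , y , comp , ∉S₀⇒∈block (S₀-or-disjoint comp C≢S₀ x∈C) , x∈C ,
          ∉S₀⇒∈block (S₀-or-disjoint comp′ C′≢S₀ y∈C′) , λ y∈C → C≢C′ (component-≡ Gᶜ-sym comp comp′ y∈C y∈C′)

        many-components : ∀ {cρ} → HasCardinality (IsMmoduleAt ρ) cρ → cρ ≥ 3 →
          ∃[ m ] ∃[ γ ] (lookup β i ≡ P {k = m} γ × 2 + m ≡ cρ ∸ 1 × IsSplit ρ (Q β) (lookup β i) ×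
            𝓜max ≐ (λ M → (∃[ j ] M ≡ ∁ X⟨ lookup γ j ⟩) ⊎ M ≡ Z))
        many-components card cρ≥3 =
          let C , x , y , comp , x∈ , x∈C , y∈ , y∉C = Z-disconnected card cρ≥3
              m , γ , eq , comps = P-of-components (good-child full i)
                (λ u∈ v∈ → near (∈block⇒∉S₀ u∈) (∈block⇒∉S₀ v∈))
                (λ {u} {v} u∈ v∉ → Eq.trans (d-sym u v) (leaving₀ (∈S₀-stable (v∉ ∘ ∉S₀⇒∈block)) (∈block⇒∉S₀ u∈)))
                comp x∈ x∈C y∈ y∉C
          in m , γ , eq , Split.count eq comps card ,
             -- The node is split at `δ` equal to `ρ`: a walk inside the block from `x` to `y` would
             -- stay in `C`.
             (k , β , i , ρ , root , refl , inj₂ Eq.refl , apex , λ conn →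
               y∉C (reached comp x∈C (Star.map (proj₂ ∘ proj₂) (conn x y (∈B⁺ x∈) (∈B⁺ y∈))))) ,
             Split.maximal eq comps

      nonconnected-case : ∃[ S₀ ] (IsLargeMmoduleAt ρ S₀ × ∃[ i ]
        (i ≢ zero × i ≢ fromℕ (2 + k) ×
         S₀ ≡ ∁ X⟨ lookup β i ⟩ ×
         IsConicalWithApex ρ β i ×
         (∀ (cρ : ℕ) → HasCardinality (IsMmoduleAt ρ) cρ →
           (cρ ≡ 2 →
             𝓜max ≐ (λ M → M ≡ X⟨ lookup β i ⟩ ⊎ M ≡ ∁ X⟨ lookup β i ⟩))
           ×
           (cρ ≥ 3 →
             ∃[ m ] ∃[ γ ]
               (lookup β i ≡ P {k = m} γ × 2 + m ≡ cρ ∸ 1 ×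
                IsSplit ρ (Q β) (lookup β i) ×
                𝓜max ≐ (λ M → (∃[ j ] M ≡ ∁ X⟨ lookup γ j ⟩) ⊎ M ≡ X⟨ lookup β i ⟩))))))
      nonconnected-case
        with a , b , a≺b , far ← ordered-far-pair
        with S₀ , comp₀ , a∈S₀ ← componentOf ρ a
        with z₀ , z₀∉ ← component-proper nc comp₀
        with i , z₀∈i ← ∈-frontiers⁻ β (full z₀) =
        S₀ , large , i , i≢zero , i≢last , S₀≡∁Z , (ρ , inj₂ Eq.refl , apex) , λ cρ card →
          (λ { refl → two-components card }) , many-components card
        where open Large a≺b far comp₀ a∈S₀ z₀∉ z₀∈i

proposition5p1 : ∀ {c ℓ₁ ℓ₂} (S : DissimilaritySpace c ℓ₁ ℓ₂) → let open Space S in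
    Robinson →
    (T : PQTree size) → IsPQTreeOfSpace T →
    (ρ : Value) → IsRho ρ →
    (∀ {k} (β : Vec (PQTree size) (2 + k)) → T ≡ P β →
    NonConnectedSpace ρ ×
    IsMmoduleAt ρ ≐ (λ M → ∃[ i ] M ≡ X⟨ lookup β i ⟩) ×
    (∀ i → diam X⟨ lookup β i ⟩ ≤ ρ) ×
    𝓜max ≐ (λ M → ∃[ i ] M ≡ ∁ X⟨ lookup β i ⟩))
    ×
    (∀ {k} (β : Vec (PQTree size) (3 + k)) → T ≡ Q β → ConnectedSpace ρ →
    𝓜max ≐ (λ M → ∃[ i ] M ≡ X⟨ lookup β i ⟩))
    ×
    (∀ {k} (β : Vec (PQTree size) (3 + k)) → T ≡ Q β → NonConnectedSpace ρ →
    ∃[ S₀ ] (IsLargeMmoduleAt ρ S₀ × ∃[ i ]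
    (i ≢ zero × i ≢ fromℕ (2 + k) ×
    S₀ ≡ ∁ X⟨ lookup β i ⟩ ×
    IsConicalWithApex ρ β i ×
    (∀ (cρ : ℕ) → HasCardinality (IsMmoduleAt ρ) cρ →
    (cρ ≡ 2 →
    𝓜max ≐ (λ M → M ≡ X⟨ lookup β i ⟩ ⊎ M ≡ ∁ X⟨ lookup β i ⟩))
    ×
    (cρ ≥ 3 →
    ∃[ m ] ∃[ γ ]
    (lookup β i ≡ P {k = m} γ × 2 + m ≡ cρ ∸ 1 ×
    IsSplit ρ T (lookup β i) ×
    𝓜max ≐ (λ M → (∃[ j ] M ≡ ∁ X⟨ lookup γ j ⟩) ⊎ M ≡ X⟨ lookup β i ⟩)))))))
proposition5p1 S _ T isPQ ρ isρ =
  (λ { β refl → PRoot.description S β isPQ ρ isρ }) ,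
  (λ { β refl → QRoot.connected-case S β isPQ ρ isρ }) ,
  (λ { β refl → QRoot.nonconnected-case S β isPQ ρ isρ })
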